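{- Let $n \geq 1$ and let $x_1,\dots,x_{2n}$ and $t$ be indeterminates. Then $$ \sum_{\lambda'\ \mathrm{even}}\ \prod_{i=2,4,6,\dots}^{2n}\left(1-t^{\lambda_i-i+2n+1}\right) s_{\lambda}(x_1,\dots,x_{2n}) = \prod_{1\leq i<j\leq 2n}\frac{1}{(x_i-x_j)}\ \mathrm{Pf}\left[\frac{(x_i-x_j)(1-t)}{(1-x_i x_j)(1-t x_i x_j)}\right]_{1\leq i<j\leq 2n}, $$ where the sum is over all partitions $\lambda=(\lambda_1\geq\cdots\geq\lambda_{2n}\geq 0)$ with at most $2n$ non-zero parts whose conjugate partition $\lambda'$ has only even parts (equivalently $\lambda_{2k-1}=\lambda_{2k}$ for all $1\leq k\leq n$), and the product on the left runs over the even integers $i$ with $2\leq i\leq 2n$.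
   Context: A partition is a finite weakly decreasing sequence of positive integers (possibly empty); a partition with at most $2n$ parts is padded with zeros so that $\lambda_1,\dots,\lambda_{2n}$ are all defined. $\lambda'$ denotes the conjugate (transpose) partition. The Schur polynomial of a partition $\lambda$ with at most $2n$ parts is $$ s_{\lambda}(x_1,\dots,x_{2n})=\frac{\det\left[x_i^{\lambda_j-j+2n}\right]_{1\leq i,j\leq 2n}}{\prod_{1\leq i<j\leq 2n}(x_i-x_j)} . $$ $\mathrm{Pf}[a_{ij}]_{1\leq i<j\leq 2n}$ denotes the Pfaffian of the $2n\times 2n$ antisymmetric matrix with entries $a_{ij}$ above the diagonal. The identity is understood as one of formal power series in $x_1,\dots,x_{2n}$ with coefficients polynomial in $t$, the entries of the Pfaffian being expanded as power series in the $x_i$. -}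

module Defs where

open import Algebra.Bundles using (CommutativeRing; RawRing; Semiring)
open import Algebra.Structures using (IsCommutativeRing)
import Algebra.Construct.Pointwise as Pointwise
import Algebra.Definitions.RawSemiring as RawSemiringDefs
import Algebra.Morphism.RingMonomorphism as RingMonomorphism
import Algebra.Properties.CommutativeMonoid.Sum as Sum
import Algebra.Properties.CommutativeSemigroup as CommutativeSemigroupProperties
import Algebra.Properties.Ring as RingProperties
import Algebra.Properties.Semiring.Exp as Exp
import Algebra.Properties.Semiring.Sum as SemiringSum
open import Data.Bool.Base using (if_then_else_)
open import Data.Fin.Base as Fin using (Fin; zero; suc; toℕ; punchIn)
import Data.Fin.Properties as Fin
import Data.Integer.Properties as ℤ
open import Data.List.Base as List using (List; []; _∷_)
open import Data.List.Relation.Binary.Subset.Propositional using (_⊆_)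
open import Data.List.Relation.Unary.All as All using (All; []; _∷_)
import Data.List.Relation.Unary.All.Properties as All
open import Data.List.Relation.Unary.Linked as Linked using (Linked)
open import Data.List.Relation.Unary.Unique.Propositional using (Unique)
open import Data.Nat.Base as ℕ using (ℕ; zero; suc; z≤n; s≤s)
open import Data.Nat.Divisibility using (_∣_)
import Data.Nat.Properties as ℕ
open import Data.Product.Base using (_×_; _,_; ∃; uncurry)
open import Data.Vec.Base as Vec using (Vec; []; _∷_; lookup; updateAt; _[_]≔_)
import Data.Vec.Properties as Vec
open import Function.Base using (_∘_)
open import Level using (0ℓ)
open import Relation.Binary.PropositionalEquality as ≡ using (_≡_; _≢_)
import Relation.Binary.Reasoning.Setoid as ≈-Reasoning
open import Relation.Nullary using (does)

module Determinants (R : RawRing 0ℓ 0ℓ) where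

  open RawRing R
  open RawSemiringDefs rawSemiring using (sum; _^_)

  Matrix : ℕ → Set
  Matrix m = Fin m → Fin m → Carrier

  -- Laplace expansion along the first row.
  det : ∀ m → Matrix m → Carrier
  det zero    A = 1#
  det (suc m) A = sum λ (j : Fin (suc m)) →
    (- 1#) ^ toℕ j * (A zero j * det m (λ k l → A (suc k) (punchIn j l)))

  -- Expansion along the first row; the column deleted together with
  -- column 0 is suc j.  Only the entries above the diagonal are used, and
  -- the value is 0# in odd size.
  pf : ∀ m → Matrix m → Carrier
  pf zero          A = 1#
  pf (suc zero)    A = 0#
  pf (suc (suc m)) A = sum λ (j : Fin (suc m)) →
    (- 1#) ^ toℕ j * (A zero (suc j) *
      pf m (λ k l → A (suc (punchIn j k)) (suc (punchIn j l))))

module Sequences (R : CommutativeRing 0ℓ 0ℓ) where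

  open CommutativeRing R
  open Sum +-commutativeMonoid using (sum; sum-cong-≋)
  open ≈-Reasoning setoid

  private
    module P = IsCommutativeRing (Pointwise.isCommutativeRing ℕ isCommutativeRing)

  Seq : Set
  Seq = ℕ → Carrier

  infix  4 _≐_
  infixl 6 _⊹_
  infixl 7 _⋆_

  _≐_ : Seq → Seq → Set
  f ≐ g = ∀ k → f k ≈ g k

  _⊹_ _⋆_ : Seq → Seq → Seq
  (f ⊹ g) k = f k + g k
  (f ⋆ g) k = sum λ (i : Fin (suc k)) → f (toℕ i) * g (k ℕ.∸ toℕ i)

  neg : Seq → Seq
  neg f k = - f k

  nought one : Seq
  nought _ = 0#
  one zero    = 1#
  one (suc _) = 0#

  private
    tail : Seq → Seq
    tail f = f ∘ suc

    _·_ : Carrier → Seq → Seq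
    (a · f) k = a * f k

  ⋆-cong : ∀ {f f′ g g′} → f ≐ f′ → g ≐ g′ → f ⋆ g ≐ f′ ⋆ g′
  ⋆-cong p q k = sum-cong-≋ {suc k} λ i → *-cong (p (toℕ i)) (q (k ℕ.∸ toℕ i))

  ⋆-distribʳ : ∀ h f g → (f ⊹ g) ⋆ h ≐ f ⋆ h ⊹ g ⋆ h
  ⋆-distribʳ h f g k = trans
    (sum-cong-≋ {suc k} λ i → distribʳ (h (k ℕ.∸ toℕ i)) (f (toℕ i)) (g (toℕ i)))
    (Sum.∑-distrib-+ +-commutativeMonoid {suc k}
      (λ i → f (toℕ i) * h (k ℕ.∸ toℕ i)) (λ i → g (toℕ i) * h (k ℕ.∸ toℕ i)))

  private
    scale : ∀ a f g → (a · f) ⋆ g ≐ a · (f ⋆ g)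
    scale a f g zero = begin
      a * f 0 * g 0 + 0#    ≈⟨ +-identityʳ _ ⟩
      a * f 0 * g 0         ≈⟨ *-assoc _ _ _ ⟩
      a * (f 0 * g 0)       ≈⟨ *-congˡ (+-identityʳ _) ⟨
      a * (f 0 * g 0 + 0#)  ∎
    scale a f g (suc k) = begin
      a * f 0 * g (suc k) + ((a · tail f) ⋆ g) k  ≈⟨ +-cong (*-assoc _ _ _) (scale a (tail f) g k) ⟩
      a * (f 0 * g (suc k)) + a * (tail f ⋆ g) k  ≈⟨ distribˡ _ _ _ ⟨
      a * (f 0 * g (suc k) + (tail f ⋆ g) k)      ∎

    last-term : ∀ f g k → (f ⋆ g) (suc k) ≈ (f ⋆ tail g) k + f (suc k) * g 0
    last-term f g zero = +-cong (sym (+-identityʳ _)) (+-identityʳ _)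
    last-term f g (suc k) = trans
      (+-congˡ (last-term (tail f) g k)) (sym (+-assoc _ _ _))

  ⋆-comm : ∀ f g → f ⋆ g ≐ g ⋆ f
  ⋆-comm f g zero    = +-congʳ (*-comm _ _)
  ⋆-comm f g (suc k) = begin
    f 0 * g (suc k) + (tail f ⋆ g) k  ≈⟨ +-comm _ _ ⟩
    (tail f ⋆ g) k + f 0 * g (suc k)  ≈⟨ +-cong (⋆-comm (tail f) g k) (*-comm _ _) ⟩
    (g ⋆ tail f) k + g (suc k) * f 0  ≈⟨ last-term g f k ⟨
    (g ⋆ f) (suc k)                   ∎

  ⋆-assoc : ∀ f g h → (f ⋆ g) ⋆ h ≐ f ⋆ (g ⋆ h)
  ⋆-assoc f g h zero = +-congʳ (begin
    (f 0 * g 0 + 0#) * h 0  ≈⟨ *-congʳ (+-identityʳ _) ⟩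
    f 0 * g 0 * h 0         ≈⟨ *-assoc _ _ _ ⟩
    f 0 * (g 0 * h 0)       ≈⟨ *-congˡ (+-identityʳ _) ⟨
    f 0 * (g 0 * h 0 + 0#)  ∎)
  ⋆-assoc f g h (suc k) = begin
    (f ⋆ g) 0 * h (suc k) + (tail (f ⋆ g) ⋆ h) k
      ≈⟨ +-cong (trans (*-congʳ (+-identityʳ _)) (*-assoc _ _ _)) (⋆-distribʳ h (f 0 · tail g) (tail f ⋆ g) k) ⟩
    f 0 * (g 0 * h (suc k)) + (((f 0 · tail g) ⋆ h) k + ((tail f ⋆ g) ⋆ h) k)
      ≈⟨ +-congˡ (+-cong (scale (f 0) (tail g) h k) (⋆-assoc (tail f) g h k)) ⟩
    f 0 * (g 0 * h (suc k)) + (f 0 * (tail g ⋆ h) k + (tail f ⋆ (g ⋆ h)) k)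
      ≈⟨ +-assoc _ _ _ ⟨
    f 0 * (g 0 * h (suc k)) + f 0 * (tail g ⋆ h) k + (tail f ⋆ (g ⋆ h)) k
      ≈⟨ +-congʳ (distribˡ _ _ _) ⟨
    f 0 * (g ⋆ h) (suc k) + (tail f ⋆ (g ⋆ h)) k ∎

  ⋆-zeroˡ : ∀ g → nought ⋆ g ≐ nought
  ⋆-zeroˡ g zero    = trans (+-identityʳ _) (zeroˡ _)
  ⋆-zeroˡ g (suc k) = trans (+-cong (zeroˡ _) (⋆-zeroˡ g k)) (+-identityʳ _)

  ⋆-identityˡ : ∀ g → one ⋆ g ≐ g
  ⋆-identityˡ g zero    = trans (+-identityʳ _) (*-identityˡ _)
  ⋆-identityˡ g (suc k) = trans (+-cong (*-identityˡ _) (⋆-zeroˡ g k)) (+-identityʳ _)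

  seqIsCommutativeRing : IsCommutativeRing _≐_ _⊹_ _⋆_ neg nought one
  seqIsCommutativeRing = record
    { isRing = record
      { +-isAbelianGroup = P.+-isAbelianGroup
      ; *-cong = ⋆-cong
      ; *-assoc = ⋆-assoc
      ; *-identity = ⋆-identityˡ , λ f k → trans (⋆-comm f one k) (⋆-identityˡ f k)
      ; distrib = (λ f g h k → trans (⋆-comm f (g ⊹ h) k)
            (trans (⋆-distribʳ f g h k) (+-cong (⋆-comm g f k) (⋆-comm h f k))))
          , ⋆-distribʳ
      }
    ; *-comm = ⋆-comm
    }

  seqRing : CommutativeRing 0ℓ 0ℓ
  seqRing = record { isCommutativeRing = seqIsCommutativeRing }

-- Univariate polynomials: lists of coefficients, constant term first,
-- compared coefficientwise (so trailing zeros do not matter)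

module Polynomials (R : CommutativeRing 0ℓ 0ℓ) where

  open CommutativeRing R hiding (_-_)
  open RingProperties ring using (-0#≈0#)
  private module S = Sequences R

  Poly : Set
  Poly = List Carrier

  coeff : Poly → ℕ → Carrier
  coeff []      _       = 0#
  coeff (a ∷ p) zero    = a
  coeff (a ∷ p) (suc k) = coeff p k

  add mul : Poly → Poly → Poly
  add []      q       = q
  add (a ∷ p) []      = a ∷ p
  add (a ∷ p) (b ∷ q) = (a + b) ∷ add p q
  mul []      q = []
  mul (a ∷ p) q = add (List.map (a *_) q) (0# ∷ mul p q)

  indeterminate : Poly
  indeterminate = 0# ∷ 1# ∷ []

  polyRawRing : RawRing 0ℓ 0ℓ
  polyRawRing = record
    { Carrier = Poly
    ; _≈_     = λ p q → ∀ k → coeff p k ≈ coeff q k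
    ; _+_     = add
    ; _*_     = mul
    ; -_      = List.map -_
    ; 0#      = []
    ; 1#      = 1# ∷ []
    }

  coeff-add : ∀ p q k → coeff (add p q) k ≈ coeff p k + coeff q k
  coeff-add []      q       k       = sym (+-identityˡ _)
  coeff-add (a ∷ p) []      k       = sym (+-identityʳ _)
  coeff-add (a ∷ p) (b ∷ q) zero    = refl
  coeff-add (a ∷ p) (b ∷ q) (suc k) = coeff-add p q k

  coeff-scale : ∀ a q k → coeff (List.map (a *_) q) k ≈ a * coeff q k
  coeff-scale a []      k       = sym (zeroʳ a)
  coeff-scale a (b ∷ q) zero    = refl
  coeff-scale a (b ∷ q) (suc k) = coeff-scale a q k

  coeff-neg : ∀ q k → coeff (List.map -_ q) k ≈ - coeff q k
  coeff-neg []      k       = sym -0#≈0#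
  coeff-neg (b ∷ q) zero    = refl
  coeff-neg (b ∷ q) (suc k) = coeff-neg q k

  coeff-mul : ∀ p q k → coeff (mul p q) k ≈ (coeff p S.⋆ coeff q) k
  coeff-mul []      q k       = sym (S.⋆-zeroˡ (coeff q) k)
  coeff-mul (a ∷ p) q zero    =
    trans (coeff-add (List.map (a *_) q) _ 0) (+-congʳ (coeff-scale a q 0))
  coeff-mul (a ∷ p) q (suc k) =
    trans (coeff-add (List.map (a *_) q) _ (suc k))
      (+-cong (coeff-scale a q (suc k)) (coeff-mul p q k))

  coeff-one : ∀ k → coeff (1# ∷ []) k ≈ S.one k
  coeff-one zero    = refl
  coeff-one (suc k) = refl

  polyRing : CommutativeRing 0ℓ 0ℓ
  polyRing = record
    { RawRing polyRawRing
    ; isCommutativeRing = RingMonomorphism.isCommutativeRing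
        {R₁ = polyRawRing} {R₂ = CommutativeRing.rawRing S.seqRing} {⟦_⟧ = coeff}
        (record
          { isRingHomomorphism = record
            { isSemiringHomomorphism = record
              { isNearSemiringHomomorphism = record
                { +-isMonoidHomomorphism = record
                  { isMagmaHomomorphism = record
                    { isRelHomomorphism = record { cong = λ p≈q → p≈q }
                    ; homo = coeff-add
                    }
                  ; ε-homo = λ _ → refl
                  }
                ; *-homo = coeff-mul
                }
              ; 1#-homo = coeff-one
              }
            ; -‿homo = coeff-neg
            }
          ; injective = λ p≈q → p≈q
          })
        S.seqIsCommutativeRing
    }

-- Formal power series in m variables: an exponent vector is sent to the
-- coefficient of the corresponding monomial

module PowerSeries (R : CommutativeRing 0ℓ 0ℓ) where

  private module R = CommutativeRing R
  open Sum R.+-commutativeMonoid using (sum; sum-cong-≋)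

  Exponent : ℕ → Set
  Exponent = Vec ℕ

  origin : ∀ {m} → Exponent m
  origin = Vec.replicate _ 0

  degree : ∀ {m} → Exponent m → ℕ
  degree = Vec.sum

  Series : ℕ → Set
  Series m = Exponent m → R.Carrier

  -- splitSum a F is the sum of F b c over all b + c = a.
  splitSum : ∀ {m} (a : Exponent m) → (Exponent m → Exponent m → R.Carrier) → R.Carrier
  splitSum []      F = F [] []
  splitSum (k ∷ a) F = sum λ (i : Fin (suc k)) →
    splitSum a λ b c → F (toℕ i ∷ b) ((k ℕ.∸ toℕ i) ∷ c)

  monomial : ∀ {m} → Exponent m → R.Carrier → Series m
  monomial e c a = if does (Vec.≡-dec ℕ._≟_ a e) then c else R.0#

  const : ∀ {m} → R.Carrier → Series m
  const = monomial origin

  X : ∀ {m} → Fin m → Series m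
  X i = monomial (origin [ i ]≔ 1) R.1#

  seriesRawRing : ℕ → RawRing 0ℓ 0ℓ
  seriesRawRing m = record
    { Carrier = Series m
    ; _≈_     = λ f g → ∀ a → f a R.≈ g a
    ; _+_     = λ f g a → f a R.+ g a
    ; _*_     = λ f g a → splitSum a λ b c → f b R.* g c
    ; -_      = λ f a → R.- f a
    ; 0#      = λ _ → R.0#
    ; 1#      = const R.1#
    }

  module Raw m = RawRing (seriesRawRing m)

  sum-at : ∀ {m n} (F : Fin n → Series m) a →
    Sum.sum R.+-commutativeMonoid (λ i → F i a) ≡
    RawSemiringDefs.sum (Raw.rawSemiring m) F a
  sum-at {n = zero}  F a = ≡.refl
  sum-at {n = suc n} F a = ≡.cong (F zero a R.+_) (sum-at (F ∘ suc) a)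

  seriesIsCommutativeRing : ∀ m →
    let
      open Raw m
    in
    IsCommutativeRing _≈_ _+_ _*_ -_ 0# 1#

  seriesRing : ℕ → CommutativeRing 0ℓ 0ℓ
  seriesRing m = record { isCommutativeRing = seriesIsCommutativeRing m }

  seriesIsCommutativeRing zero =
    RingMonomorphism.isCommutativeRing
      {R₁ = seriesRawRing 0} {R₂ = R.rawRing} {⟦_⟧ = λ f → f []}
      (record
        { isRingHomomorphism = record
          { isSemiringHomomorphism = record
            { isNearSemiringHomomorphism = record
              { +-isMonoidHomomorphism = record
                { isMagmaHomomorphism = record
                  { isRelHomomorphism = record { cong = λ f≈g → f≈g [] }
                  ; homo = λ _ _ → R.refl
                  }
                ; ε-homo = R.refl
                }
              ; *-homo = λ _ _ → R.refl
              }
            ; 1#-homo = R.refl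
            }
          ; -‿homo = λ _ → R.refl
          }
        ; injective = λ { f≈g [] → f≈g }
        })
      R.isCommutativeRing
  seriesIsCommutativeRing (suc m) =
    RingMonomorphism.isCommutativeRing
      {R₁ = seriesRawRing (suc m)} {R₂ = CommutativeRing.rawRing S.seqRing}
      {⟦_⟧ = λ f k a → f (k ∷ a)}
      (record
        { isRingHomomorphism = record
          { isSemiringHomomorphism = record
            { isNearSemiringHomomorphism = record
              { +-isMonoidHomomorphism = record
                { isMagmaHomomorphism = record
                  { isRelHomomorphism = record { cong = λ f≈g k a → f≈g (k ∷ a) }
                  ; homo = λ _ _ _ _ → R.refl
                  }
                ; ε-homo = λ _ _ → R.refl
                }
              ; *-homo = λ f g k a → R.reflexive
                  (sum-at {n = suc k} (λ i a → splitSum a λ b c →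
                    f (toℕ i ∷ b) R.* g ((k ℕ.∸ toℕ i) ∷ c)) a)
              }
            ; 1#-homo = λ { zero a → R.refl ; (suc k) a → R.refl }
            }
          ; -‿homo = λ _ _ _ → R.refl
          }
        ; injective = λ { f≈g (k ∷ a) → f≈g k a }
        })
      S.seqIsCommutativeRing
    where
    module S = Sequences (seriesRing m)

  splitSum-cong : ∀ {m} (a : Exponent m) {F G : Exponent m → Exponent m → R.Carrier} →
    (∀ b c → degree b ℕ.+ degree c ≡ degree a → F b c R.≈ G b c) →
    splitSum a F R.≈ splitSum a G
  splitSum-cong []      F≈G = F≈G [] [] ≡.refl
  splitSum-cong (k ∷ a) F≈G = sum-cong-≋ {suc k} λ i →
    splitSum-cong a λ b c eq → F≈G (toℕ i ∷ b) ((k ℕ.∸ toℕ i) ∷ c) (begin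
      (toℕ i ℕ.+ degree b) ℕ.+ ((k ℕ.∸ toℕ i) ℕ.+ degree c)
        ≡⟨ +-interchange (toℕ i) (degree b) (k ℕ.∸ toℕ i) (degree c) ⟩
      (toℕ i ℕ.+ (k ℕ.∸ toℕ i)) ℕ.+ (degree b ℕ.+ degree c)
        ≡⟨ ≡.cong₂ ℕ._+_ (ℕ.m+[n∸m]≡n (ℕ.≤-pred (Fin.toℕ<n i))) eq ⟩
      k ℕ.+ degree a ∎)
    where
    open ≡.≡-Reasoning
    open CommutativeSemigroupProperties ℕ.+-commutativeSemigroup
      using () renaming (interchange to +-interchange)

  splitSum-zero : ∀ {m} (a : Exponent m) → splitSum a (λ _ _ → R.0#) R.≈ R.0#
  splitSum-zero []      = R.refl
  splitSum-zero (k ∷ a) = R.trans (sum-cong-≋ {suc k} λ _ → splitSum-zero a)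
    (Sum.sum-replicate-zero R.+-commutativeMonoid (suc k))

  degree≡0 : ∀ {m} (a : Exponent m) → degree a ≡ 0 → a ≡ origin
  degree≡0 []         _  = ≡.refl
  degree≡0 (zero ∷ a) eq = ≡.cong (0 ∷_) (degree≡0 a eq)

  -- Only finitely many a have a given degree, and (1 - g)ᵏ has no terms
  -- of degree below k when g has constant term 1, so the coefficients of
  -- Σₖ (1 - g)ᵏ are finite sums.  If g has another constant term the value is
  -- meaningless.
  infix 9 _⁻¹

  _⁻¹ : ∀ {m} → Series m → Series m
  _⁻¹ {m} g a = sum λ (k : Fin (suc (degree a))) → ((1# - g) ^ toℕ k) a
    where
    open CommutativeRing (seriesRing m) using (1#; _-_; semiring)
    open Exp semiring using (_^_)

  geometric-sum : ∀ {m} →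
    let
      open CommutativeRing (seriesRing m)
      open Exp semiring
    in
    ∀ y N → (1# - y) * Sum.sum +-commutativeMonoid (λ (k : Fin N) → y ^ toℕ k) ≈ 1# - y ^ N
  geometric-sum {m} y zero = begin
    (1# - y) * 0#  ≈⟨ zeroʳ (1# - y) ⟩
    0#             ≈⟨ -‿inverseʳ 1# ⟨
    1# - 1#        ∎
    where
    open CommutativeRing (seriesRing m)
    open ≈-Reasoning setoid
  geometric-sum {m} y (suc N) = begin
    (1# - y) * (1# + S′)                  ≈⟨ *-congˡ {1# - y} (+-congˡ {1#} (pull N)) ⟩
    (1# - y) * (1# + y * S)               ≈⟨ distribˡ (1# - y) 1# (y * S) ⟩
    (1# - y) * 1# + (1# - y) * (y * S)    ≈⟨ +-cong (*-identityʳ (1# - y)) (x∙yz≈y∙xz (1# - y) y S) ⟩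
    (1# - y) + y * ((1# - y) * S)         ≈⟨ +-congˡ {1# - y} (*-congˡ {y} (geometric-sum y N)) ⟩
    (1# - y) + y * (1# - y ^ N)           ≈⟨ +-congˡ {1# - y} (x[y-z]≈xy-xz y 1# (y ^ N)) ⟩
    (1# - y) + (y * 1# - y * y ^ N)       ≈⟨ +-congˡ {1# - y} (+-congʳ { - (y * y ^ N)} (*-identityʳ y)) ⟩
    (1# - y) + (y - y * y ^ N)            ≈⟨ +-assoc 1# (- y) (y - y * y ^ N) ⟩
    1# + (- y + (y - y * y ^ N))          ≈⟨ +-congˡ {1#} (+-assoc (- y) y (- (y * y ^ N))) ⟨
    1# + ((- y + y) - y * y ^ N)          ≈⟨ +-congˡ {1#} (+-congʳ { - (y * y ^ N)} (-‿inverseˡ y)) ⟩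
    1# + (0# - y * y ^ N)                 ≈⟨ +-congˡ {1#} (+-identityˡ (- (y * y ^ N))) ⟩
    1# - y * y ^ N                        ∎
    where
    open CommutativeRing (seriesRing m)
    open Exp semiring
    open RingProperties ring using (x[y-z]≈xy-xz)
    open CommutativeSemigroupProperties *-commutativeSemigroup using (x∙yz≈y∙xz)
    open ≈-Reasoning setoid
    S S′ : Carrier
    S  = Sum.sum +-commutativeMonoid (λ (k : Fin N) → y ^ toℕ k)
    S′ = Sum.sum +-commutativeMonoid (λ (k : Fin N) → y ^ suc (toℕ k))
    pull : ∀ N → Sum.sum +-commutativeMonoid (λ (k : Fin N) → y ^ suc (toℕ k)) ≈
                 y * Sum.sum +-commutativeMonoid (λ (k : Fin N) → y ^ toℕ k)
    pull N = sym (SemiringSum.*-distribˡ-sum semiring {N} y (λ k → y ^ toℕ k))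

  power-order : ∀ {m} →
    let
      open CommutativeRing (seriesRing m)
      open Exp semiring
    in
    ∀ y → y origin R.≈ R.0# → ∀ k a → degree a ℕ.< k → (y ^ k) a R.≈ R.0#
  power-order {m} y y₀ (suc k) a |a|≤k = R.trans
    (splitSum-cong a λ b c eq → term b c eq (degree b) ≡.refl)
    (splitSum-zero a)
    where
    open CommutativeRing (seriesRing m) using (semiring)
    open Exp semiring using (_^_)
    term : ∀ b c → degree b ℕ.+ degree c ≡ degree a → ∀ d → degree b ≡ d →
      y b R.* (y ^ k) c R.≈ R.0#
    term b c eq zero    |b|≡0 with ≡.refl ← degree≡0 b |b|≡0 =
      R.trans (R.*-congʳ y₀) (R.zeroˡ _)
    term b c eq (suc d) |b|≡1+d = R.trans (R.*-congˡ (power-order y y₀ k c |c|<k)) (R.zeroʳ _)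
      where
      |c|<k : degree c ℕ.< k
      |c|<k = ℕ.≤-trans
        (s≤s (ℕ.m≤n+m (degree c) d))
        (ℕ.≤-trans (ℕ.≤-reflexive (≡.trans (≡.cong (ℕ._+ degree c) (≡.sym |b|≡1+d)) eq)) (ℕ.≤-pred |a|≤k))

  sum-truncate : ∀ (F : ℕ → R.Carrier) {M N} → M ℕ.≤ N → (∀ k → M ℕ.≤ k → F k R.≈ R.0#) →
    sum {N} (F ∘ toℕ) R.≈ sum {M} (F ∘ toℕ)
  sum-truncate F {N = N} z≤n F≈0 = R.trans (sum-cong-≋ {N} λ k → F≈0 (toℕ k) z≤n)
    (Sum.sum-replicate-zero R.+-commutativeMonoid N)
  sum-truncate F (s≤s M≤N) F≈0 =
    R.+-congˡ (sum-truncate (F ∘ suc) M≤N λ k M≤k → F≈0 (suc k) (s≤s M≤k))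

  ⁻¹-inverseʳ : ∀ {m} (g : Series m) → g origin R.≈ R.1# →
    let
      open CommutativeRing (seriesRing m)
    in
    g * g ⁻¹ ≈ 1#
  ⁻¹-inverseʳ {m} g g₀ a = begin
    (g * g ⁻¹) a
      ≈⟨ splitSum-cong a (λ b c eq → R.*-cong (double b) (truncated c (ℕ.≤-trans (ℕ.m≤n+m (degree c) (degree b)) (ℕ.≤-reflexive eq)))) ⟩
    ((1# - y) * S) a
      ≈⟨ geometric-sum y (suc (degree a)) a ⟩
    1# a R.- (y ^ suc (degree a)) a
      ≈⟨ R.+-congˡ (R.-‿cong (power-order y y₀ (suc (degree a)) a ℕ.≤-refl)) ⟩
    1# a R.- R.0#
      ≈⟨ R.trans (R.+-congˡ (RingProperties.-0#≈0# R.ring)) (R.+-identityʳ _) ⟩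
    1# a ∎
    where
    open CommutativeRing (seriesRing m) using (_*_; _-_; 1#; semiring; +-commutativeMonoid)
    open Exp semiring using (_^_)
    open ≈-Reasoning R.setoid
    y S : Series m
    y = 1# - g
    S = Sum.sum +-commutativeMonoid (λ (k : Fin (suc (degree a))) → y ^ toℕ k)
    1-origin : ∀ {m} → const {m} R.1# origin ≡ R.1#
    1-origin {zero}  = ≡.refl
    1-origin {suc m} = 1-origin {m}
    y₀ : y origin R.≈ R.0#
    y₀ = R.trans (R.+-cong (R.reflexive (1-origin {m})) (R.-‿cong g₀)) (R.-‿inverseʳ R.1#)
    double : ∀ b → g b R.≈ (1# - y) b
    double b = R.sym (R.trans
      (R.+-congˡ (R.trans (R.sym (RingProperties.-‿+-comm R.ring (1# b) (R.- g b)))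
        (R.+-congˡ (RingProperties.-‿involutive R.ring (g b)))))
      (R.trans (R.sym (R.+-assoc _ _ _)) (R.trans (R.+-congʳ (R.-‿inverseʳ (1# b))) (R.+-identityˡ (g b)))))
    truncated : ∀ c → degree c ℕ.≤ degree a → (g ⁻¹) c R.≈ S c
    truncated c |c|≤|a| = R.trans
      (R.sym (sum-truncate (λ k → (y ^ k) c) (s≤s |c|≤|a|) λ k |c|<k → power-order y y₀ k c |c|<k))
      (R.reflexive (sum-at {n = suc (degree a)} (λ k → y ^ toℕ k) c))

  -- Exact division by X i - X j for i ≢ j.  If f ≈ (X i - X j) * q, then the
  -- coefficients at exponents (p, r) in the variables i and j satisfy
  -- q(p, r) = f(p+1, r) + q(p+1, r-1), hence q(p, r) = Σₖ≤ᵣ f(p+1+k, r-k).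
  -- If f is not a multiple of X i - X j the value is meaningless.
  divide : ∀ {m} (i j : Fin m) → Series m → Series m
  divide i j f a = sum λ (k : Fin (suc (lookup a j))) →
    f (updateAt (updateAt a i (suc (toℕ k) ℕ.+_)) j (ℕ._∸ toℕ k))

  splitSum-zero′ : ∀ {m} (a : Exponent m) {F : Exponent m → Exponent m → R.Carrier} →
    (∀ b c → F b c R.≈ R.0#) → splitSum a F R.≈ R.0#
  splitSum-zero′ a F≈0 = R.trans (splitSum-cong a λ b c _ → F≈0 b c) (splitSum-zero a)

  sum-zero : ∀ n {F : Fin n → R.Carrier} → (∀ k → F k R.≈ R.0#) → sum F R.≈ R.0#
  sum-zero n F≈0 = R.trans (sum-cong-≋ {n} F≈0) (Sum.sum-replicate-zero R.+-commutativeMonoid n)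

  X-tail : ∀ {m} (i : Fin m) (q : Series (suc m)) k a →
    CommutativeRing._*_ (seriesRing (suc m)) (X (suc i)) q (k ∷ a) R.≈
    CommutativeRing._*_ (seriesRing m) (X i) (λ b → q (k ∷ b)) a
  X-tail i q k a = R.trans
    (R.+-congˡ (sum-zero k λ _ → splitSum-zero′ a λ _ _ → R.zeroˡ _))
    (R.+-identityʳ _)

  X*-updateAt : ∀ {m} (i : Fin m) (q : Series m) a →
    let
      open CommutativeRing (seriesRing m)
    in
    (X i * q) (updateAt a i suc) R.≈ q a
  X*-updateAt {suc m} zero q (k ∷ a) = R.trans
    (R.+-congʳ (splitSum-zero′ a λ _ _ → R.zeroˡ _))
    (R.trans (R.+-identityˡ _) (*-identityˡ q (k ∷ a)))
    where
    open CommutativeRing (seriesRing (suc m))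
  X*-updateAt (suc i) q (k ∷ a) = R.trans
    (X-tail i q k (updateAt a i suc)) (X*-updateAt i (λ b → q (k ∷ b)) a)

  X*-zero : ∀ {m} (i : Fin m) (q : Series m) a → lookup a i ≡ 0 →
    let
      open CommutativeRing (seriesRing m)
    in
    (X i * q) a R.≈ R.0#
  X*-zero zero q (zero ∷ a) _ = R.trans
    (R.+-identityʳ _) (splitSum-zero′ a λ _ _ → R.zeroˡ _)
  X*-zero (suc i) q (k ∷ a) eq = R.trans (X-tail i q k a) (X*-zero i (λ b → q (k ∷ b)) a eq)

  divide-cong : ∀ {m} (i j : Fin m) {f g} →
    let
      open CommutativeRing (seriesRing m)
    in
    f ≈ g → divide i j f ≈ divide i j g
  divide-cong i j f≈g a = sum-cong-≋ {suc (lookup a j)} λ k →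
    f≈g (updateAt (updateAt a i (suc (toℕ k) ℕ.+_)) j (ℕ._∸ toℕ k))

  telescope : ∀ n (F Q : ℕ → R.Carrier) →
    (∀ k → k ℕ.< n → F k R.≈ Q k R.- Q (suc k)) → F n R.≈ Q n →
    sum {suc n} (F ∘ toℕ) R.≈ Q 0
  telescope zero    F Q _    end = R.trans (R.+-identityʳ _) end
  telescope (suc n) F Q step end = begin
    F 0 R.+ sum {suc n} (F ∘ suc ∘ toℕ)
      ≈⟨ R.+-cong (step 0 (s≤s z≤n)) (telescope n (F ∘ suc) (Q ∘ suc) (λ k k<n → step (suc k) (s≤s k<n)) end) ⟩
    (Q 0 R.- Q 1) R.+ Q 1    ≈⟨ R.+-assoc _ _ _ ⟩
    Q 0 R.+ (R.- Q 1 R.+ Q 1) ≈⟨ R.+-congˡ (R.-‿inverseˡ _) ⟩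
    Q 0 R.+ R.0#             ≈⟨ R.+-identityʳ _ ⟩
    Q 0                      ∎
    where
    open ≈-Reasoning R.setoid

  divide-correct : ∀ {m} (i j : Fin m) → i ≢ j → (f q : Series m) →
    let
      open CommutativeRing (seriesRing m)
    in
    (X i - X j) * q ≈ f → divide i j f ≈ q
  divide-correct {m} i j i≢j f q eq a = R.trans
    (telescope (lookup a j) F Q step end)
    (R.reflexive (≡.cong q (≡.trans (Vec.updateAt-id j _) (Vec.updateAt-id i a))))
    where
    open CommutativeRing (seriesRing m) using (_*_; _-_; ring)
    open ≡.≡-Reasoning
    at up : ℕ → Exponent m
    at k = updateAt (updateAt a i (k ℕ.+_)) j (ℕ._∸ k)
    up k = updateAt (updateAt a i (suc k ℕ.+_)) j (ℕ._∸ k)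
    F Q : ℕ → R.Carrier
    F k = f (up k)
    Q k = q (at k)
    up-i : ∀ k → updateAt (at k) i suc ≡ up k
    up-i k = begin
      updateAt (updateAt (updateAt a i (k ℕ.+_)) j (ℕ._∸ k)) i suc
        ≡⟨ Vec.updateAt-commutes i j i≢j (updateAt a i (k ℕ.+_)) ⟩
      updateAt (updateAt (updateAt a i (k ℕ.+_)) i suc) j (ℕ._∸ k)
        ≡⟨ ≡.cong (λ v → updateAt v j (ℕ._∸ k)) (Vec.updateAt-updateAt i a) ⟩
      up k ∎
    look-j : ∀ k → lookup (updateAt a i (suc k ℕ.+_)) j ≡ lookup a j
    look-j k = Vec.lookup∘updateAt′ j i (i≢j ∘ ≡.sym) a
    up-j : ∀ k → k ℕ.< lookup a j → updateAt (at (suc k)) j suc ≡ up k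
    up-j k k<aⱼ = Vec.updateAt-updateAt-local j (updateAt a i (suc k ℕ.+_))
      (≡.trans (≡.cong (λ r → suc (r ℕ.∸ suc k)) (look-j k))
        (≡.trans (≡.sym (ℕ.+-∸-assoc 1 k<aⱼ)) (≡.cong (ℕ._∸ k) (≡.sym (look-j k)))))
    expand : ∀ b → f b R.≈ (X i * q) b R.- (X j * q) b
    expand b = R.trans (R.sym (eq b)) (RingProperties.[y-z]x≈yx-zx ring q (X i) (X j) b)
    Xi : ∀ k → (X i * q) (up k) R.≈ Q k
    Xi k = R.trans (R.reflexive (≡.cong (X i * q) (≡.sym (up-i k)))) (X*-updateAt i q (at k))
    step : ∀ k → k ℕ.< lookup a j → F k R.≈ Q k R.- Q (suc k)
    step k k<aⱼ = R.trans (expand (up k)) (R.+-cong (Xi k) (R.-‿cong (R.trans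
      (R.reflexive (≡.cong (X j * q) (≡.sym (up-j k k<aⱼ)))) (X*-updateAt j q (at (suc k))))))
    end : F (lookup a j) R.≈ Q (lookup a j)
    end = R.trans (expand (up r)) (R.trans
      (R.+-cong (Xi r) (R.trans (R.-‿cong (X*-zero j q (up r) (begin
        lookup (up r) j
          ≡⟨ Vec.lookup∘updateAt j (updateAt a i (suc r ℕ.+_)) ⟩
        lookup (updateAt a i (suc r ℕ.+_)) j ℕ.∸ r
          ≡⟨ ≡.cong (ℕ._∸ r) (look-j r) ⟩
        r ℕ.∸ r
          ≡⟨ ℕ.n∸n≡0 r ⟩
        0 ∎))) (RingProperties.-0#≈0# R.ring)))
      (R.+-identityʳ _))
      where r = lookup a j

  pairs : ∀ m → List (Fin m × Fin m)
  pairs m = List.filter (uncurry Fin._<?_) (List.cartesianProduct (List.allFin m) (List.allFin m))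

  Δ : ∀ {m} → Series m
  Δ {m} = List.foldr (λ (i , j) g → (X i - X j) * g) 1# (pairs m)
    where
    open CommutativeRing (seriesRing m)

  -- Exact division by Δ, one factor at a time.  Every alternating polynomial or
  -- series, such as the bialternant numerator of a Schur polynomial or the
  -- Pfaffian of an antisymmetric array f(xᵢ, xⱼ), is a multiple of Δ.
  infixl 7 _/Δ

  _/Δ : ∀ {m} → Series m → Series m
  f /Δ = List.foldl (λ g (i , j) → divide i j g) f (pairs _)

  /Δ-correct : ∀ {m} (f q : Series m) →
    let
      open CommutativeRing (seriesRing m)
    in
    Δ * q ≈ f → f /Δ ≈ q
  /Δ-correct {m} f q = go (pairs m) (All.map Fin.<⇒≢
      (All.all-filter (uncurry Fin._<?_) (List.cartesianProduct (List.allFin m) (List.allFin m)))) f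
    where
    open CommutativeRing (seriesRing m)
    go : ∀ ps → All (uncurry _≢_) ps → ∀ f →
      List.foldr (λ (i , j) g → (X i - X j) * g) 1# ps * q ≈ f →
      List.foldl (λ g (i , j) → divide i j g) f ps ≈ q
    go [] _ f eq = trans (sym eq) (*-identityˡ q)
    go ((i , j) ∷ ps) (i≢j ∷ ps≢) f eq = go ps ps≢ (divide i j f)
      (sym {divide i j f} (divide-correct i j i≢j f (rest * q)
        (trans {(X i - X j) * (rest * q)} (sym {(X i - X j) * rest * q} (*-assoc (X i - X j) rest q)) eq)))
      where rest = List.foldr (λ (i , j) g → (X i - X j) * g) 1# ps

  -- Σ f over the indices satisfying P converges to s: every coefficient of
  -- the partial sums over finite sets of such indices is eventually that of s.
  HasSum : ∀ {m} {I : Set} → (I → Set) → (I → Series m) → Series m → Set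
  HasSum {m} {I} P f s = ∀ a → ∃ λ (S : List I) → Unique S × All P S ×
    (∀ T → Unique T → All P T → S ⊆ T →
      List.foldr (λ ν g → f ν + g) 0# T a R.≈ s a)
    where
    open CommutativeRing (seriesRing m) using (_+_; 0#)

record Partition : Set where
  field
    parts      : List ℕ
    positive   : All (1 ℕ.≤_) parts
    decreasing : Linked ℕ._≥_ parts

open Partition public

-- So duplicate-free lists of partitions have distinct underlying sequences.
parts-injective : ∀ {μ ν} → parts μ ≡ parts ν → μ ≡ ν
parts-injective {record { parts = ps }} {record { parts = ps }} ≡.refl =
  ≡.cong₂ (λ p d → record { parts = ps ; positive = p ; decreasing = d })
    (All.irrelevant ℕ.≤-irrelevant _ _) (Linked.irrelevant ℕ.≤-irrelevant _ _)

-- Entries are numbered from 1 and padded with zeros; number 0 is not used.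
entry : List ℕ → ℕ → ℕ
entry _        zero          = 0
entry []       (suc i)       = 0
entry (p ∷ ps) (suc zero)    = p
entry (p ∷ ps) (suc (suc i)) = entry ps (suc i)

part : Partition → ℕ → ℕ
part ν = entry (parts ν)

-- The parts of the conjugate: the j-th one, for 1 ≤ j ≤ ν₁, is the number of
-- i with νᵢ ≥ j.
conjugate : Partition → List ℕ
conjugate ν = List.map (λ j → List.length (List.filter (j ℕ.≤?_) (parts ν)))
                       (List.applyUpTo suc (part ν 1))

EvenConjugate : Partition → Set
EvenConjugate ν = All (2 ∣_) (conjugate ν)

-- Fin m counts from 0, the formulas count from 1.
index : ∀ {m} → Fin m → ℕ
index i = suc (toℕ i)

module ℤ[t] = Polynomials ℤ.+-*-commutativeRing

module ℤ[t]⟦x⟧ (m : ℕ) where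

  open PowerSeries ℤ[t].polyRing public using (_⁻¹; _/Δ; HasSum; Δ)
  private module PS = PowerSeries ℤ[t].polyRing

  open CommutativeRing (PS.seriesRing m) public
  open RawSemiringDefs (Semiring.rawSemiring semiring) public using (_^_; product)
  open Determinants (CommutativeRing.rawRing (PS.seriesRing m)) public using (det; pf)

  t : Carrier
  t = PS.const ℤ[t].indeterminate

  x : Fin m → Carrier
  x = PS.X

  alternant : Partition → Carrier
  alternant ν = det m λ i j → x i ^ (part ν (index j) ℕ.+ m ℕ.∸ index j)

  schur : Partition → Carrier
  schur ν = alternant ν /Δ

{-# OPTIONS --safe #-}

-- Since (1 - t) / ((1 - z) (1 - t z)) = Σₖ (1 - tᵏ⁺¹) zᵏ, the Pfaffian has the
-- entries Σₖ cₖ (xᵢᵏ⁺¹ xⱼᵏ - xᵢᵏ xⱼᵏ⁺¹) with cₖ = 1 - tᵏ⁺¹, i.e. it is the Pfaffian of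
-- the 2-form Σₖ cₖ ξₖ₊₁ ∧ ξₖ, where ξₖ = Σᵢ xᵢᵏ eᵢ.  The exponential of this form
-- is the product of the 1 + cₖ ξₖ₊₁ ∧ ξₖ, and its top coefficient is the Pfaffian.
-- Expanding the product, one gets the sum over k₁ > … > kₙ of Π cₖᵣ times the
-- determinant with column exponents k₁ + 1, k₁, …, kₙ + 1, kₙ, which vanishes when two
-- exponents agree; the others are the alternants of the ν with ν₂ᵣ₋₁ = ν₂ᵣ.
-- Division by Δ is linear and each coefficient of the quotient depends on
-- finitely many coefficients, so the sums may be truncated and divided termwise.
module Submission where

open import Algebra.Bundles using (CommutativeRing; Semiring)
import Algebra.Definitions.RawSemiring as RawSemiringDefs
import Algebra.Properties.CommutativeSemigroup as CommutativeSemigroupProperties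
import Algebra.Properties.CommutativeSemiring.Exp as Exp
import Algebra.Properties.Monoid.Sum as MonoidSum
import Algebra.Properties.Ring as RingProperties
import Algebra.Properties.Semiring.Sum as SemiringSum
open import Data.Fin.Base as Fin using (Fin; zero; suc; toℕ; punchIn)
import Data.Fin.Properties as Fin
open import Data.List.Base as List using (List; []; _∷_; length; tabulate)
open import Data.List.Membership.Propositional using (_∈_)
import Data.List.Membership.Propositional.Properties as ∈
import Data.List.Properties as List
open import Data.List.Relation.Binary.Permutation.Propositional using (↭-sym)
open import Data.List.Relation.Binary.Permutation.Propositional.Properties
  using (∈-resp-↭; shift)
open import Data.List.Relation.Binary.Subset.Propositional using (_⊆_)
open import Data.List.Relation.Unary.All as All using (All; []; _∷_)
import Data.List.Relation.Unary.All.Properties as All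
open import Data.List.Relation.Unary.AllPairs using ([]; _∷_)
open import Data.List.Relation.Unary.Any using (here; there)
open import Data.List.Relation.Unary.Linked as Linked using (Linked; []; [-]; _∷_)
open import Data.List.Relation.Unary.Linked.Properties using (Linked⇒All)
open import Data.List.Relation.Unary.Unique.Propositional using (Unique)
import Data.List.Relation.Unary.Unique.Propositional.Properties as Unique
open import Data.Nat.Base as ℕ using (ℕ; zero; suc; z≤n; s≤s)
open import Data.Nat.Divisibility using (_∣_; _∣0; ∣-refl; ∣m∣n⇒∣m+n; ∣m+n∣m⇒∣n; >⇒∤)
import Data.Nat.Properties as ℕ
open import Data.Product.Base using (_×_; _,_; ∃)
open import Data.Sum.Base using (_⊎_; inj₁; inj₂; fromInj₂)
open import Data.Vec.Base using (_∷_; []; lookup; updateAt)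
import Data.Vec.Properties as Vec
open import Function.Base using (_∘_; id)
open import Level using (0ℓ)
open import Relation.Binary.Core using (Rel)
open import Relation.Binary.PropositionalEquality as ≡ using (_≡_; ≢-sym)
import Relation.Binary.Reasoning.Setoid as ≈-Reasoning
open import Relation.Nullary using (¬_; yes; no; contradiction)
open import Defs

-- Paired sequences and their column exponents

double : ℕ → ℕ
double zero    = zero
double (suc n) = suc (suc (double n))

-- Underlying sequences of the partitions ν with at most 2n parts, parts at
-- most B and ν₂ₖ₋₁ = ν₂ₖ for all k.
paired : ℕ → ℕ → List (List ℕ)
paired zero    B       = [] ∷ []
paired (suc n) zero    = [] ∷ []
paired (suc n) (suc B) =
  paired (suc n) B List.++ List.map (λ ps → suc B ∷ suc B ∷ ps) (paired n (suc B))

paired-0 : ∀ n → paired n 0 ≡ [] ∷ []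
paired-0 zero    = ≡.refl
paired-0 (suc n) = ≡.refl

-- The summands are ordered so that exponents compute: putting a pair `p ∷ p` in front of `ps` and
-- raising `d` by two keeps the later exponents definitionally, and the first two become `suc k` and
-- `k` for `k` the old `d` plus `p`.
exponent : ℕ → List ℕ → ℕ → ℕ
exponent d ps i = (d ℕ.∸ i) ℕ.+ entry ps i

-- Exterior algebra, determinants and Pfaffians

module Forms (R : CommutativeRing 0ℓ 0ℓ) (I : Set) where

  open CommutativeRing R hiding (zero)
  open RingProperties ring
  open SemiringSum semiring
    using (sum; sum-cong-≋; *-distribˡ-sum)
  open RawSemiringDefs (Semiring.rawSemiring semiring) using (_^_)
  open CommutativeSemigroupProperties +-commutativeSemigroup
    using () renaming (interchange to +-interchange)
  open CommutativeSemigroupProperties *-commutativeSemigroup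
    using (x∙yz≈y∙xz)
  open Determinants rawRing
  open ≈-Reasoning setoid

  -- An element y of the exterior algebra on basis vectors eᵢ, i ∈ I, is given by
  -- its coefficients: y (r₁ ∷ … ∷ rₖ ∷ []) belongs to e r₁ ∧ … ∧ e rₖ.
  Form : Set
  Form = List I → Carrier

  infixr 8 _∧_

  -- The vector `w` either takes the first index or passes it at the cost of a sign, with `y`
  -- keeping that index in front.
  _∧_ : (I → Carrier) → Form → Form
  (w ∧ y) []       = 0#
  (w ∧ y) (r ∷ rs) = w r * y rs - (w ∧ (y ∘ (r ∷_))) rs

  δ : Form
  δ []      = 1#
  δ (_ ∷ _) = 0#

  wedge : ∀ {d} → (Fin d → I → Carrier) → Form
  wedge {zero}  w = δ
  wedge {suc d} w = w zero ∧ wedge (w ∘ suc)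

  sub-cong : ∀ {a a′ b b′} → a ≈ a′ → b ≈ b′ → a - b ≈ a′ - b′
  sub-cong p q = +-cong p (-‿cong q)

  -- Every term of the recursion removes exactly one index from `rs`. Hence expansions known in a
  -- single degree can be used under `∧`.
  ∧-cong-length : ∀ w {y y′} rs → (∀ l → suc (length l) ≡ length rs → y l ≈ y′ l) →
    (w ∧ y) rs ≈ (w ∧ y′) rs
  ∧-cong-length w []       y≈y′ = refl
  ∧-cong-length w (r ∷ rs) y≈y′ = sub-cong (*-congˡ (y≈y′ rs ≡.refl))
    (∧-cong-length w rs λ l eq → y≈y′ (r ∷ l) (≡.cong suc eq))

  ∧-congˡ : ∀ w {y y′} → (∀ l → y l ≈ y′ l) → ∀ rs → (w ∧ y) rs ≈ (w ∧ y′) rs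
  ∧-congˡ w y≈y′ rs = ∧-cong-length w rs λ l _ → y≈y′ l

  ∧-+ : ∀ w y y′ rs → (w ∧ (λ l → y l + y′ l)) rs ≈ (w ∧ y) rs + (w ∧ y′) rs
  ∧-+ w y y′ []       = sym (+-identityʳ 0#)
  ∧-+ w y y′ (r ∷ rs) = begin
    w r * (y rs + y′ rs) - (w ∧ (λ l → y (r ∷ l) + y′ (r ∷ l))) rs
      ≈⟨ sub-cong (distribˡ _ _ _) (∧-+ w (y ∘ (r ∷_)) (y′ ∘ (r ∷_)) rs) ⟩
    (w r * y rs + w r * y′ rs) - ((w ∧ (y ∘ (r ∷_))) rs + (w ∧ (y′ ∘ (r ∷_))) rs)
      ≈⟨ +-congˡ (-‿+-comm _ _) ⟨
    (w r * y rs + w r * y′ rs) + (- (w ∧ (y ∘ (r ∷_))) rs - (w ∧ (y′ ∘ (r ∷_))) rs)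
      ≈⟨ +-interchange _ _ _ _ ⟩
    (w ∧ y) (r ∷ rs) + (w ∧ y′) (r ∷ rs) ∎

  ∧-* : ∀ w c y rs → (w ∧ (λ l → c * y l)) rs ≈ c * (w ∧ y) rs
  ∧-* w c y []       = sym (zeroʳ c)
  ∧-* w c y (r ∷ rs) = trans
    (sub-cong (x∙yz≈y∙xz _ _ _) (∧-* w c (y ∘ (r ∷_)) rs))
    (sym (x[y-z]≈xy-xz _ _ _))

  ∧-0 : ∀ w rs → (w ∧ (λ _ → 0#)) rs ≈ 0#
  ∧-0 w rs = trans (∧-congˡ w (λ _ → sym (zeroˡ 0#)) rs) (trans (∧-* w 0# (λ _ → 0#) rs) (zeroˡ _))

  ∧-neg : ∀ w y rs → (w ∧ (λ l → - y l)) rs ≈ - (w ∧ y) rs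
  ∧-neg w y rs = trans (∧-congˡ w (λ l → sym (-1*x≈-x (y l))) rs)
    (trans (∧-* w (- 1#) y rs) (-1*x≈-x _))

  ∧-sum : ∀ n w (y : Fin n → Form) rs →
    (w ∧ (λ l → sum λ j → y j l)) rs ≈ sum λ j → (w ∧ y j) rs
  ∧-sum zero    w y rs = ∧-0 w rs
  ∧-sum (suc n) w y rs = trans (∧-+ w (y zero) (λ l → sum λ j → y (suc j) l) rs)
    (+-congˡ (∧-sum n w (y ∘ suc) rs))

  +-∧ : ∀ u w y rs → ((λ i → u i + w i) ∧ y) rs ≈ (u ∧ y) rs + (w ∧ y) rs
  +-∧ u w y []       = sym (+-identityʳ 0#)
  +-∧ u w y (r ∷ rs) = begin
    (u r + w r) * y rs - ((λ i → u i + w i) ∧ (y ∘ (r ∷_))) rs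
      ≈⟨ sub-cong (distribʳ _ _ _) (+-∧ u w (y ∘ (r ∷_)) rs) ⟩
    (u r * y rs + w r * y rs) - ((u ∧ (y ∘ (r ∷_))) rs + (w ∧ (y ∘ (r ∷_))) rs)
      ≈⟨ +-congˡ (-‿+-comm _ _) ⟨
    (u r * y rs + w r * y rs) + (- (u ∧ (y ∘ (r ∷_))) rs - (w ∧ (y ∘ (r ∷_))) rs)
      ≈⟨ +-interchange _ _ _ _ ⟩
    (u ∧ y) (r ∷ rs) + (w ∧ y) (r ∷ rs) ∎

  *-∧ : ∀ c w y rs → ((λ i → c * w i) ∧ y) rs ≈ c * (w ∧ y) rs
  *-∧ c w y []       = sym (zeroʳ c)
  *-∧ c w y (r ∷ rs) = trans
    (sub-cong (*-assoc _ _ _) (*-∧ c w (y ∘ (r ∷_)) rs))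
    (sym (x[y-z]≈xy-xz _ _ _))

  0-∧ : ∀ y rs → ((λ _ → 0#) ∧ y) rs ≈ 0#
  0-∧ y []       = refl
  0-∧ y (r ∷ rs) = trans (sub-cong (zeroˡ _) (0-∧ (y ∘ (r ∷_)) rs)) (-‿inverseʳ 0#)

  neg-∧ : ∀ w y rs → ((λ i → - w i) ∧ y) rs ≈ - (w ∧ y) rs
  neg-∧ w y []       = sym -0#≈0#
  neg-∧ w y (r ∷ rs) = trans
    (sub-cong (sym (-‿distribˡ-* _ _)) (neg-∧ w (y ∘ (r ∷_)) rs))
    (-‿+-comm _ _)

  -- Either one of `u` and `v` takes `r`, or both pass it and the two signs cancel. The bracket is
  -- antisymmetric in `u` and `v`, which drives the inductions for `∧-anticomm` and `∧-square`.
  ∧-∧-∷ : ∀ u v y r rs → (u ∧ v ∧ y) (r ∷ rs) ≈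
    (u r * (v ∧ y) rs - v r * (u ∧ y) rs) + (u ∧ v ∧ (y ∘ (r ∷_))) rs
  ∧-∧-∷ u v y r rs = begin
    u r * (v ∧ y) rs - (u ∧ (λ l → v r * y l - (v ∧ y′) l)) rs
      ≈⟨ sub-cong refl (∧-+ u (λ l → v r * y l) (λ l → - (v ∧ y′) l) rs) ⟩
    u r * (v ∧ y) rs - ((u ∧ (λ l → v r * y l)) rs + (u ∧ (λ l → - (v ∧ y′) l)) rs)
      ≈⟨ sub-cong refl (+-cong (∧-* u (v r) y rs) (∧-neg u (v ∧ y′) rs)) ⟩
    u r * (v ∧ y) rs - (v r * (u ∧ y) rs - (u ∧ v ∧ y′) rs)
      ≈⟨ +-congˡ (-‿+-comm _ _) ⟨
    u r * (v ∧ y) rs + (- (v r * (u ∧ y) rs) - (- (u ∧ v ∧ y′) rs))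
      ≈⟨ +-assoc _ _ _ ⟨
    (u r * (v ∧ y) rs - v r * (u ∧ y) rs) - (- (u ∧ v ∧ y′) rs)
      ≈⟨ +-congˡ (-‿involutive _) ⟩
    (u r * (v ∧ y) rs - v r * (u ∧ y) rs) + (u ∧ v ∧ y′) rs ∎
    where
    y′ : Form
    y′ = y ∘ (r ∷_)

  ∧-anticomm : ∀ u v y rs → (u ∧ v ∧ y) rs ≈ - (v ∧ u ∧ y) rs
  ∧-anticomm u v y []       = sym -0#≈0#
  ∧-anticomm u v y (r ∷ rs) = begin
    (u ∧ v ∧ y) (r ∷ rs)
      ≈⟨ ∧-∧-∷ u v y r rs ⟩
    (u r * (v ∧ y) rs - v r * (u ∧ y) rs) + (u ∧ v ∧ (y ∘ (r ∷_))) rs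
      ≈⟨ +-cong (sym (⁻¹-anti-homo-// _ _)) (∧-anticomm u v (y ∘ (r ∷_)) rs) ⟩
    - (v r * (u ∧ y) rs - u r * (v ∧ y) rs) - (v ∧ u ∧ (y ∘ (r ∷_))) rs
      ≈⟨ -‿+-comm _ _ ⟩
    - ((v r * (u ∧ y) rs - u r * (v ∧ y) rs) + (v ∧ u ∧ (y ∘ (r ∷_))) rs)
      ≈⟨ -‿cong (∧-∧-∷ v u y r rs) ⟨
    - (v ∧ u ∧ y) (r ∷ rs) ∎

  -- Anticommutativity alone would only show that twice the value vanishes, so the induction is
  -- repeated with equal vectors, where the bracket cancels exactly.
  ∧-square : ∀ w y rs → (w ∧ w ∧ y) rs ≈ 0#
  ∧-square w y []       = refl
  ∧-square w y (r ∷ rs) = begin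
    (w ∧ w ∧ y) (r ∷ rs)
      ≈⟨ ∧-∧-∷ w w y r rs ⟩
    (w r * (w ∧ y) rs - w r * (w ∧ y) rs) + (w ∧ w ∧ (y ∘ (r ∷_))) rs
      ≈⟨ +-cong (-‿inverseʳ _) (∧-square w (y ∘ (r ∷_)) rs) ⟩
    0# + 0#
      ≈⟨ +-identityʳ 0# ⟩
    0# ∎

  sign : ∀ j a → - ((- 1#) ^ j * a) ≈ (- 1#) ^ suc j * a
  sign j a = trans (sym (-1*x≈-x _)) (sym (*-assoc _ _ _))

  neg-sum : ∀ {n} (f : Fin n → Carrier) → - sum f ≈ sum λ j → - f j
  neg-sum {n} f = trans (sym (-1*x≈-x _))
    (trans (*-distribˡ-sum (- 1#) f) (sum-cong-≋ {n} λ j → -1*x≈-x (f j)))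

  -- Terms are sorted by the index which `w` takes; passing `j` earlier indices gives the sign. For
  -- `w` a row of an array this has the shape of the Pfaffian expansion.
  ∧-tabulate : ∀ {m} w y (ρ : Fin (suc m) → I) → (w ∧ y) (tabulate ρ) ≈
    sum λ (j : Fin (suc m)) → (- 1#) ^ toℕ j * (w (ρ j) * y (tabulate (ρ ∘ punchIn j)))
  ∧-tabulate {zero}  w y ρ = +-cong (sym (*-identityˡ _)) -0#≈0#
  ∧-tabulate {suc m} w y ρ = +-cong (sym (*-identityˡ _)) (begin
    - (w ∧ (y ∘ (ρ zero ∷_))) (tabulate (ρ ∘ suc))
      ≈⟨ -‿cong (∧-tabulate w (y ∘ (ρ zero ∷_)) (ρ ∘ suc)) ⟩
    - sum (λ (j : Fin (suc m)) → (- 1#) ^ toℕ j * term j)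
      ≈⟨ neg-sum (λ (j : Fin (suc m)) → (- 1#) ^ toℕ j * term j) ⟩
    sum (λ (j : Fin (suc m)) → - ((- 1#) ^ toℕ j * term j))
      ≈⟨ sum-cong-≋ {suc m} (λ j → sign (toℕ j) (term j)) ⟩
    sum (λ (j : Fin (suc m)) → (- 1#) ^ suc (toℕ j) * term j) ∎)
    where
    term : Fin (suc m) → Carrier
    term j = w (ρ (suc j)) * y (tabulate (ρ ∘ punchIn (suc j)))

  -- Terms are sorted by the factor which takes `r`. This is Laplace expansion along a row, although
  -- `wedge` is built column by column.
  wedge-∷ : ∀ {d} (w : Fin (suc d) → I → Carrier) r rs → wedge w (r ∷ rs) ≈
    sum λ (j : Fin (suc d)) → (- 1#) ^ toℕ j * (w j r * wedge (w ∘ punchIn j) rs)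
  wedge-∷ {zero}  w r rs = +-cong (sym (*-identityˡ _))
    (trans (-‿cong (∧-0 (w zero) rs)) -0#≈0#)
  wedge-∷ {suc d} w r rs = +-cong (sym (*-identityˡ _)) (begin
    - (w zero ∧ (λ l → wedge (w ∘ suc) (r ∷ l))) rs
      ≈⟨ -‿cong (∧-congˡ (w zero) (wedge-∷ (w ∘ suc) r) rs) ⟩
    - (w zero ∧ (λ l → sum λ (j : Fin (suc d)) → (- 1#) ^ toℕ j * (w (suc j) r * minor j l))) rs
      ≈⟨ -‿cong (∧-sum (suc d) (w zero) (λ j l → (- 1#) ^ toℕ j * (w (suc j) r * minor j l)) rs) ⟩
    - sum (λ (j : Fin (suc d)) → (w zero ∧ (λ l → (- 1#) ^ toℕ j * (w (suc j) r * minor j l))) rs)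
      ≈⟨ neg-sum (λ (j : Fin (suc d)) → (w zero ∧ (λ l → (- 1#) ^ toℕ j * (w (suc j) r * minor j l))) rs) ⟩
    sum (λ (j : Fin (suc d)) → - (w zero ∧ (λ l → (- 1#) ^ toℕ j * (w (suc j) r * minor j l))) rs)
      ≈⟨ sum-cong-≋ {suc d} (λ j → trans
           (-‿cong (trans (∧-* (w zero) ((- 1#) ^ toℕ j) (λ l → w (suc j) r * minor j l) rs)
             (*-congˡ (∧-* (w zero) (w (suc j) r) (minor j) rs))))
           (sign (toℕ j) _)) ⟩
    sum (λ (j : Fin (suc d)) → (- 1#) ^ suc (toℕ j) * (w (suc j) r * wedge (w ∘ punchIn (suc j)) rs)) ∎)
    where
    minor : Fin (suc d) → Form
    minor j = wedge (w ∘ suc ∘ punchIn j)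

  det-wedge : ∀ m (w : Fin m → I → Carrier) (ρ : Fin m → I) →
    det m (λ i j → w j (ρ i)) ≈ wedge w (tabulate ρ)
  det-wedge zero    w ρ = refl
  det-wedge (suc m) w ρ = sym (trans (wedge-∷ w (ρ zero) (tabulate (ρ ∘ suc)))
    (sum-cong-≋ {suc m} λ j → *-congˡ {(- 1#) ^ toℕ j} (*-congˡ {w j (ρ zero)}
      (sym (det-wedge m (w ∘ punchIn j) (ρ ∘ suc))))))

  -- Then y is the exponential of the 2-form with coefficients A.
  record IsPfaffian (A : I → I → Carrier) (y : Form) : Set where
    field
      at-[] : y [] ≈ 1#
      at-∷  : ∀ r rs → y (r ∷ rs) ≈ (A r ∧ y) rs

  open IsPfaffian

  IsPfaffian-resp : ∀ {A y y′} → (∀ rs → y rs ≈ y′ rs) → IsPfaffian A y → IsPfaffian A y′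
  IsPfaffian-resp {A} y≈y′ isPf = record
    { at-[] = trans (sym (y≈y′ [])) (at-[] isPf)
    ; at-∷  = λ r rs → trans (sym (y≈y′ (r ∷ rs)))
        (trans (at-∷ isPf r rs) (∧-congˡ (A r) y≈y′ rs))
    }

  -- `at-∷` followed by `∧-tabulate` is the recursion that defines `pf`.
  pf-tabulate : ∀ {A y} → IsPfaffian A y → ∀ m (ρ : Fin m → I) →
    pf m (λ i j → A (ρ i) (ρ j)) ≈ y (tabulate ρ)
  pf-tabulate isPf zero          ρ = sym (at-[] isPf)
  pf-tabulate isPf (suc zero)    ρ = sym (at-∷ isPf (ρ zero) [])
  pf-tabulate {A} {y} isPf (suc (suc m)) ρ = sym (begin
    y (tabulate ρ)
      ≈⟨ at-∷ isPf (ρ zero) (tabulate (ρ ∘ suc)) ⟩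
    (A (ρ zero) ∧ y) (tabulate (ρ ∘ suc))
      ≈⟨ ∧-tabulate (A (ρ zero)) y (ρ ∘ suc) ⟩
    sum (λ (j : Fin (suc m)) → (- 1#) ^ toℕ j *
      (A (ρ zero) (ρ (suc j)) * y (tabulate (ρ ∘ suc ∘ punchIn j))))
      ≈⟨ sum-cong-≋ {suc m} (λ j → *-congˡ {(- 1#) ^ toℕ j} (*-congˡ {A (ρ zero) (ρ (suc j))}
           (sym (pf-tabulate isPf m (ρ ∘ suc ∘ punchIn j))))) ⟩
    pf (suc (suc m)) (λ i j → A (ρ i) (ρ j)) ∎)

  ∧-linear : ∀ w c y z rs → (w ∧ (λ l → y l + c * z l)) rs ≈ (w ∧ y) rs + c * (w ∧ z) rs
  ∧-linear w c y z rs = trans (∧-+ w y (λ l → c * z l) rs) (+-congˡ (∧-* w c z rs))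

  ∧-absorb : ∀ w c y z rs → (w ∧ z) rs ≈ 0# → (w ∧ (λ l → y l + c * z l)) rs ≈ (w ∧ y) rs
  ∧-absorb w c y z rs eq = trans (∧-linear w c y z rs)
    (trans (+-congˡ (trans (*-congˡ eq) (zeroʳ c))) (+-identityʳ _))

  -- exp (ω + c u ∧ v) = exp ω ∧ (1 + c u ∧ v), as (u ∧ v) ∧ (u ∧ v) = 0.
  update-isPfaffian : ∀ {A y} c u v → IsPfaffian A y →
    IsPfaffian (λ r s → A r s + c * (u r * v s - v r * u s)) (λ l → y l + c * (u ∧ v ∧ y) l)
  update-isPfaffian {A} {y} c u v isPf = record
    { at-[] = trans (+-congˡ (zeroʳ c)) (trans (+-identityʳ _) (at-[] isPf))
    ; at-∷  = λ r rs → begin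
      y (r ∷ rs) + c * (u ∧ v ∧ y) (r ∷ rs)
        ≈⟨ +-cong (at-∷ isPf r rs) (*-congˡ (trans (∧-∧-∷ u v y r rs) (+-congˡ (swap r rs)))) ⟩
      (A r ∧ y) rs + c * ((u r * (v ∧ y) rs - v r * (u ∧ y) rs) + (A r ∧ u ∧ v ∧ y) rs)
        ≈⟨ +-congˡ (trans (distribˡ _ _ _) (+-comm _ _)) ⟩
      (A r ∧ y) rs + (c * (A r ∧ u ∧ v ∧ y) rs + c * (u r * (v ∧ y) rs - v r * (u ∧ y) rs))
        ≈⟨ +-assoc _ _ _ ⟨
      ((A r ∧ y) rs + c * (A r ∧ u ∧ v ∧ y) rs) + c * (u r * (v ∧ y) rs - v r * (u ∧ y) rs)
        -- The correction in `y′` has a repeated vector when it stands behind `v` or `u`, so there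
        -- `y` may be replaced by `y′`.
        ≈⟨ +-cong (∧-linear (A r) c y (u ∧ v ∧ y) rs) (*-congˡ (sub-cong
             (*-congˡ (∧-absorb v c y (u ∧ v ∧ y) rs (vuv rs)))
             (*-congˡ (∧-absorb u c y (u ∧ v ∧ y) rs (∧-square u (v ∧ y) rs))))) ⟨
      (A r ∧ y′) rs + c * (u r * (v ∧ y′) rs - v r * (u ∧ y′) rs)
        ≈⟨ +-congˡ (*-congˡ (+-cong (*-∧ (u r) v y′ rs)
             (trans (neg-∧ (λ s → v r * u s) y′ rs) (-‿cong (*-∧ (v r) u y′ rs))))) ⟨
      (A r ∧ y′) rs + c * (((λ s → u r * v s) ∧ y′) rs + ((λ s → - (v r * u s)) ∧ y′) rs)
        ≈⟨ +-congˡ (*-congˡ (+-∧ (λ s → u r * v s) (λ s → - (v r * u s)) y′ rs)) ⟨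
      (A r ∧ y′) rs + c * ((λ s → u r * v s - v r * u s) ∧ y′) rs
        ≈⟨ +-congˡ (*-∧ c (λ s → u r * v s - v r * u s) y′ rs) ⟨
      (A r ∧ y′) rs + ((λ s → c * (u r * v s - v r * u s)) ∧ y′) rs
        ≈⟨ +-∧ (A r) (λ s → c * (u r * v s - v r * u s)) y′ rs ⟨
      ((λ s → A r s + c * (u r * v s - v r * u s)) ∧ y′) rs ∎
    }
    where
    y′ : Form
    y′ l = y l + c * (u ∧ v ∧ y) l
    vuv : ∀ rs → (v ∧ u ∧ v ∧ y) rs ≈ 0#
    vuv rs = trans (∧-anticomm v u (v ∧ y) rs)
      (trans (-‿cong (trans (∧-congˡ u (∧-square v y) rs) (∧-0 u rs))) -0#≈0#)
    swap : ∀ r rs → (u ∧ v ∧ (y ∘ (r ∷_))) rs ≈ (A r ∧ u ∧ v ∧ y) rs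
    swap r rs = begin
      (u ∧ v ∧ (y ∘ (r ∷_))) rs  ≈⟨ ∧-congˡ u (∧-congˡ v (at-∷ isPf r)) rs ⟩
      -- Moving `A r` to the front, past `v` and then `u`, changes the sign twice.
      (u ∧ v ∧ A r ∧ y) rs       ≈⟨ ∧-congˡ u (∧-anticomm v (A r) y) rs ⟩
      (u ∧ (λ l → - (A r ∧ v ∧ y) l)) rs  ≈⟨ ∧-neg u (A r ∧ v ∧ y) rs ⟩
      - (u ∧ A r ∧ v ∧ y) rs     ≈⟨ -‿cong (∧-anticomm u (A r) (v ∧ y) rs) ⟩
      - (- (A r ∧ u ∧ v ∧ y) rs) ≈⟨ -‿involutive _ ⟩
      (A r ∧ u ∧ v ∧ y) rs       ∎

-- Finite sums over lists

module ListSum (R : CommutativeRing 0ℓ 0ℓ) where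

  open CommutativeRing R hiding (zero)

  ∑ : {X : Set} → List X → (X → Carrier) → Carrier
  ∑ xs f = List.foldr (λ x s → f x + s) 0# xs

  ∑-cong : {X : Set} (xs : List X) {f g : X → Carrier} → (∀ x → f x ≈ g x) → ∑ xs f ≈ ∑ xs g
  ∑-cong []       f≈g = refl
  ∑-cong (x ∷ xs) f≈g = +-cong (f≈g x) (∑-cong xs f≈g)

  ∑-++ : {X : Set} (xs ys : List X) (f : X → Carrier) → ∑ (xs List.++ ys) f ≈ ∑ xs f + ∑ ys f
  ∑-++ []       ys f = sym (+-identityˡ _)
  ∑-++ (x ∷ xs) ys f = trans (+-congˡ (∑-++ xs ys f)) (sym (+-assoc _ _ _))

  ∑-map : {X Z : Set} (h : X → Z) (xs : List X) (f : Z → Carrier) →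
    ∑ (List.map h xs) f ≡ ∑ xs (f ∘ h)
  ∑-map h []       f = ≡.refl
  ∑-map h (x ∷ xs) f = ≡.cong (f (h x) +_) (∑-map h xs f)

  *-∑ : {X : Set} (c : Carrier) (xs : List X) (f : X → Carrier) → c * ∑ xs f ≈ ∑ xs (λ x → c * f x)
  *-∑ c []       f = zeroʳ c
  *-∑ c (x ∷ xs) f = trans (distribˡ _ _ _) (+-congˡ (*-∑ c xs f))

-- Expansion of the Pfaffian into determinants

module MinorSummation (R : CommutativeRing 0ℓ 0ℓ) (I : Set)
  (c : ℕ → CommutativeRing.Carrier R) (ξ : ℕ → I → CommutativeRing.Carrier R) where

  open CommutativeRing R hiding (zero)
  open ListSum R
  open Forms R I
  open RawSemiringDefs (Semiring.rawSemiring semiring) using (product)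
  open Determinants rawRing
  open ≈-Reasoning setoid

  -- The coefficients of the 2-form `Σ cₖ ξₖ₊₁ ∧ ξₖ`, cut off to `k < K`.
  A : ℕ → I → I → Carrier
  A zero    r s = 0#
  A (suc K) r s = A K r s + c K * (ξ (suc K) r * ξ K s - ξ K r * ξ (suc K) s)

  -- The product of all 1 + cₖ ξₖ₊₁ ∧ ξₖ with k + 1 < K.  Since ξ K ∧ ξ K = 0, the
  -- last factor of Y (suc K) acts as 1 behind ξ K; using Y K there leaves only
  -- products without repeated ξₖ.
  Y : ℕ → Form
  Y zero          rs = δ rs
  Y (suc zero)    rs = δ rs
  Y (suc (suc K)) rs = Y (suc K) rs + c K * (ξ (suc K) ∧ ξ K ∧ Y K) rs

  ξ∧Y : ∀ K rs → (ξ K ∧ Y (suc K)) rs ≈ (ξ K ∧ Y K) rs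
  ξ∧Y zero    rs = refl
  ξ∧Y (suc K) rs = ∧-absorb (ξ (suc K)) (c K) (Y (suc K)) (ξ (suc K) ∧ ξ K ∧ Y K) rs
    (∧-square (ξ (suc K)) (ξ K ∧ Y K) rs)

  Y-isPfaffian : ∀ K → IsPfaffian (A K) (Y (suc K))
  Y-isPfaffian zero    = record
    { at-[] = refl
    ; at-∷  = λ r rs → sym (0-∧ δ rs)
    }
  Y-isPfaffian (suc K) = IsPfaffian-resp
    -- `update-isPfaffian` leaves `Y (suc K)` behind `ξ K`, where the definition of `Y` has `Y K`.
    (λ rs → +-congˡ (*-congˡ (∧-congˡ (ξ (suc K)) (ξ∧Y K) rs)))
    (update-isPfaffian (c K) (ξ (suc K)) (ξ K) (Y-isPfaffian K))

  Y-[] : ∀ K → Y K [] ≈ 1#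
  Y-[] zero    = refl
  Y-[] (suc K) = IsPfaffian.at-[] (Y-isPfaffian K)

  ∧-vanishing : ∀ w y d → (∀ l → d ℕ.< length l → y l ≈ 0#) →
    ∀ rs → suc d ℕ.< length rs → (w ∧ y) rs ≈ 0#
  ∧-vanishing w y d y≈0 rs d<|rs| = trans
    (∧-cong-length w rs λ l eq → y≈0 l (ℕ.≤-pred (≡.subst (suc d ℕ.<_) (≡.sym eq) d<|rs|)))
    (∧-0 w rs)

  -- `Y K` is built from the `ξₖ` with `k < K`, each at most once in a product, so its degree is at
  -- most `K`.
  Y-vanishing : ∀ K rs → K ℕ.< length rs → Y K rs ≈ 0#
  Y-vanishing zero          (_ ∷ _) _ = refl
  Y-vanishing (suc zero)    (_ ∷ _) _ = refl
  Y-vanishing (suc (suc K)) rs K<|rs| = trans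
    (+-cong (Y-vanishing (suc K) rs (ℕ.<-trans (ℕ.n<1+n _) K<|rs|))
      (trans (*-congˡ (∧-vanishing (ξ (suc K)) (ξ K ∧ Y K) (suc K)
        (∧-vanishing (ξ K) (Y K) K (Y-vanishing K)) rs K<|rs|)) (zeroʳ _)))
    (+-identityʳ 0#)

  -- The columns 2, 4, ..., `double n` are used: for paired `ps` they carry the smaller exponent of
  -- each pair `k + 1, k`.
  weight : ℕ → List ℕ → Carrier
  weight n ps = product λ (k : Fin n) → c (exponent (double n) ps (2 ℕ.+ double (toℕ k)))

  columns : ∀ d → List ℕ → Fin d → I → Carrier
  columns d ps j = ξ (exponent d ps (index j))

  term : ℕ → List ℕ → Form
  term n ps rs = weight n ps * wedge (columns (double n) ps) rs

  ∧-∑ : {X : Set} (w : I → Carrier) (xs : List X) (y : X → Form) → ∀ rs →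
    (w ∧ (λ l → ∑ xs (λ x → y x l))) rs ≈ ∑ xs (λ x → (w ∧ y x) rs)
  ∧-∑ w []       y rs = ∧-0 w rs
  ∧-∑ w (x ∷ xs) y rs = trans (∧-+ w (y x) (λ l → ∑ xs (λ x → y x l)) rs)
    (+-congˡ (∧-∑ w xs y rs))

  -- Every determinant gains the leading columns `ξ (suc k)` and `ξ k`. They use up two indices, so
  -- the expansion of `y` is required only in degree `double n`.
  prepend-pair : ∀ n qs k y rs → length rs ≡ double (suc n) →
    (∀ l → length l ≡ double n → y l ≈ ∑ qs (λ ps → term n ps l)) →
    c k * (ξ (suc k) ∧ ξ k ∧ y) rs ≈
    ∑ qs (λ ps → (c k * weight n ps) * (ξ (suc k) ∧ ξ k ∧ wedge (columns (double n) ps)) rs)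
  prepend-pair n qs k y rs |rs| y≈∑ = begin
    c k * (u ∧ v ∧ y) rs
      ≈⟨ *-congˡ (∧-cong-length u rs λ l eq → ∧-cong-length v l λ l′ eq′ →
           y≈∑ l′ (ℕ.suc-injective (ℕ.suc-injective
             (≡.trans (≡.cong suc eq′) (≡.trans eq |rs|))))) ⟩
    c k * (u ∧ v ∧ (λ l → ∑ qs (λ ps → term n ps l))) rs
      ≈⟨ *-congˡ (trans (∧-congˡ u (∧-∑ v qs (term n)) rs)
           (∧-∑ u qs (λ ps → v ∧ term n ps) rs)) ⟩
    c k * ∑ qs (λ ps → (u ∧ v ∧ term n ps) rs)
      ≈⟨ *-∑ (c k) qs (λ ps → (u ∧ v ∧ term n ps) rs) ⟩
    ∑ qs (λ ps → c k * (u ∧ v ∧ term n ps) rs)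
      ≈⟨ ∑-cong qs (λ ps → trans (*-congˡ (trans
           (∧-congˡ u (∧-* v (weight n ps) (wedge (columns (double n) ps))) rs)
           (∧-* u (weight n ps) (v ∧ wedge (columns (double n) ps)) rs)))
           (sym (*-assoc _ _ _))) ⟩
    ∑ qs (λ ps → (c k * weight n ps) * (u ∧ v ∧ wedge (columns (double n) ps)) rs) ∎
    where
    u v : I → Carrier
    u = ξ (suc k)
    v = ξ k

  -- The last factor of `Y` is either left out, which lowers the bound on the parts by one, or used,
  -- which sets the first two parts to the bound and leaves one pair fewer under the same bound.
  -- This is the recursion of `paired`.
  Y-expansion : ∀ n B rs → length rs ≡ double n →
    Y (double n ℕ.+ B) rs ≈ ∑ (paired n B) (λ ps → term n ps rs)
  Y-expansion zero    B    [] _ = trans (Y-[] B)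
    (sym (trans (+-identityʳ _) (*-identityˡ 1#)))
  Y-expansion (suc n) zero rs |rs| = begin
    Y (suc k) rs + c k * (ξ (suc k) ∧ ξ k ∧ Y k) rs
      -- Here the degree is at most `2n + 1`, while `rs` has `2n + 2` indices: with bound zero the
      -- last factor must be used.
      ≈⟨ +-cong (Y-vanishing (suc k) rs (ℕ.≤-reflexive
           (≡.trans (≡.cong (λ i → suc (suc i)) (ℕ.+-identityʳ (double n))) (≡.sym |rs|))))
         (prepend-pair n ([] ∷ []) k (Y k) rs |rs| λ l |l| →
           trans (Y-expansion n 0 l |l|)
             (reflexive (≡.cong (λ qs → ∑ qs (λ ps → term n ps l)) (paired-0 n)))) ⟩
    0# + ∑ ([] ∷ []) (λ ps → (c k * weight n ps) * (ξ (suc k) ∧ ξ k ∧ wedge (columns (double n) ps)) rs)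
      ≈⟨ +-identityˡ _ ⟩
    ∑ ([] ∷ []) (λ ps → term (suc n) ps rs) ∎
    where
    k : ℕ
    k = double n ℕ.+ 0
  Y-expansion (suc n) (suc B) rs |rs| = begin
    Y (suc k) rs + c k * (ξ (suc k) ∧ ξ k ∧ Y k) rs
      ≈⟨ +-cong (trans (reflexive (≡.cong (λ i → Y (suc i) rs) (ℕ.+-suc (double n) B)))
           (Y-expansion (suc n) B rs |rs|))
         (prepend-pair n (paired n (suc B)) k (Y k) rs |rs| (Y-expansion n (suc B))) ⟩
    ∑ (paired (suc n) B) (λ ps → term (suc n) ps rs) +
      ∑ (paired n (suc B)) (λ ps → term (suc n) (suc B ∷ suc B ∷ ps) rs)
      ≡⟨ ≡.cong (∑ (paired (suc n) B) (λ ps → term (suc n) ps rs) +_) (∑-map (λ ps → suc B ∷ suc B ∷ ps) (paired n (suc B)) (λ ps → term (suc n) ps rs)) ⟨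
    ∑ (paired (suc n) B) (λ ps → term (suc n) ps rs) +
      ∑ (List.map (λ ps → suc B ∷ suc B ∷ ps) (paired n (suc B))) (λ ps → term (suc n) ps rs)
      ≈⟨ ∑-++ (paired (suc n) B) _ (λ ps → term (suc n) ps rs) ⟨
    ∑ (paired (suc n) (suc B)) (λ ps → term (suc n) ps rs) ∎
    where
    k : ℕ
    k = double n ℕ.+ suc B

  pf-expansion : ∀ m n B K → m ≡ double n → double n ℕ.+ B ≡ suc K → (ρ : Fin m → I) →
    pf m (λ i j → A K (ρ i) (ρ j)) ≈
    ∑ (paired n B) (λ ps → weight n ps * det m (λ i j → columns m ps j (ρ i)))
  pf-expansion m n B K ≡.refl eq ρ = begin
    pf m (λ i j → A K (ρ i) (ρ j))
      ≈⟨ pf-tabulate (Y-isPfaffian K) m ρ ⟩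
    Y (suc K) (tabulate ρ)
      ≡⟨ ≡.cong (λ i → Y i (tabulate ρ)) eq ⟨
    Y (double n ℕ.+ B) (tabulate ρ)
      ≈⟨ Y-expansion n B (tabulate ρ) (List.length-tabulate ρ) ⟩
    ∑ (paired n B) (λ ps → term n ps (tabulate ρ))
      ≈⟨ ∑-cong (paired n B) (λ ps → *-congˡ (sym (det-wedge m (columns m ps) ρ))) ⟩
    ∑ (paired n B) (λ ps → weight n ps * det m (λ i j → columns m ps j (ρ i))) ∎

-- Partitions with even conjugate

data Paired : List ℕ → Set where
  []   : Paired []
  pair : ∀ {p ps} → Paired ps → Paired (p ∷ p ∷ ps)

record Admissible (n B : ℕ) (ps : List ℕ) : Set where
  constructor admissible
  field
    pos    : All (1 ℕ.≤_) ps
    desc   : Linked ℕ._≥_ ps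
    short  : length ps ℕ.≤ double n
    bound  : entry ps 1 ℕ.≤ B
    twins  : Paired ps

infixr 5 _∷≥_

_∷≥_ : ∀ {p ps} → entry ps 1 ℕ.≤ p → Linked ℕ._≥_ ps → Linked ℕ._≥_ (p ∷ ps)
_∷≥_ {ps = []}     _   _ = [-]
_∷≥_ {ps = q ∷ ps} q≤p l = q≤p ∷ l

head-bound : ∀ {p ps} → Linked ℕ._≥_ (p ∷ ps) → entry ps 1 ℕ.≤ p
head-bound [-]     = z≤n
head-bound (q ∷ _) = q

paired-sound : ∀ n B → All (Admissible n B) (paired n B)
paired-sound zero    B       = admissible [] [] z≤n z≤n [] ∷ []
paired-sound (suc n) zero    = admissible [] [] z≤n z≤n [] ∷ []
paired-sound (suc n) (suc B) = All.++⁺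
  (All.map (λ (admissible p d s b t) → admissible p d s (ℕ.m≤n⇒m≤1+n b) t) (paired-sound (suc n) B))
  (All.map⁺ (All.map
    (λ (admissible p d s b t) →
      admissible (s≤s z≤n ∷ s≤s z≤n ∷ p) (ℕ.≤-refl ∷ b ∷≥ d) (s≤s (s≤s s)) ℕ.≤-refl (pair t))
    (paired-sound n (suc B))))

paired-complete : ∀ n B {ps} → Admissible n B ps → ps ∈ paired n B
paired-complete zero    B       {[]}          _                = here ≡.refl
paired-complete (suc n) zero    {[]}          _                = here ≡.refl
paired-complete (suc n) zero    {zero ∷ _}    (admissible (() ∷ _) _ _ _ _)
paired-complete (suc n) (suc B) {[]}          _                =
  ∈.∈-++⁺ˡ (paired-complete (suc n) B (admissible [] [] z≤n z≤n []))
paired-complete (suc n) (suc B) {p ∷ p ∷ ps} (admissible pos@(_ ∷ _ ∷ pos′) desc@(_ ∷ desc′) (s≤s (s≤s short)) bound twins@(pair twins′))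
  with ℕ.m≤n⇒m<n∨m≡n bound
... | inj₁ (s≤s p≤B) = ∈.∈-++⁺ˡ
  (paired-complete (suc n) B (admissible pos desc (s≤s (s≤s short)) p≤B twins))
... | inj₂ ≡.refl = ∈.∈-++⁺ʳ (paired (suc n) B) (∈.∈-map⁺ (λ ps → suc B ∷ suc B ∷ ps)
  (paired-complete n (suc B) (admissible pos′ (Linked.tail desc′) short (head-bound desc′) twins′)))

-- The two halves of the recursion are told apart by the first part: at most `B` in one, `suc B` in
-- the other.
paired-unique : ∀ n B → Unique (paired n B)
paired-unique zero    B       = [] ∷ []
paired-unique (suc n) zero    = [] ∷ []
paired-unique (suc n) (suc B) = Unique.++⁺ (paired-unique (suc n) B)
  (Unique.map⁺ (λ { ≡.refl → ≡.refl }) (paired-unique n (suc B)))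
  λ { (l∈ , r∈) → disjoint l∈ (∈.∈-map⁻ (λ ps → suc B ∷ suc B ∷ ps) r∈) }
  where
  disjoint : ∀ {ps} → ps ∈ paired (suc n) B →
    ¬ (∃ λ qs → qs ∈ paired n (suc B) × ps ≡ suc B ∷ suc B ∷ qs)
  disjoint l∈ (_ , _ , ≡.refl) =
    ℕ.1+n≰n (Admissible.bound (All.lookup (paired-sound (suc n) B) l∈))

atLeast : ℕ → List ℕ → ℕ
atLeast j ps = length (List.filter (j ℕ.≤?_) ps)

atLeast-pair : ∀ j p ps → (atLeast j (p ∷ p ∷ ps) ≡ 2 ℕ.+ atLeast j ps) ⊎ (atLeast j (p ∷ p ∷ ps) ≡ atLeast j ps)
atLeast-pair j p ps with j ℕ.≤? p
... | yes j≤p = inj₁ (≡.cong length (≡.trans (List.filter-accept (j ℕ.≤?_) j≤p)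
  (≡.cong (p ∷_) (List.filter-accept (j ℕ.≤?_) j≤p))))
... | no  j≰p = inj₂ (≡.cong length (≡.trans (List.filter-reject (j ℕ.≤?_) j≰p)
  (List.filter-reject (j ℕ.≤?_) j≰p)))

atLeast-small : ∀ j {ps} → Linked ℕ._≥_ ps → entry ps 1 ℕ.< j → atLeast j ps ≡ 0
atLeast-small j {[]}     _    _   = ≡.refl
atLeast-small j {p ∷ ps} desc p<j = ≡.cong length (List.filter-none (j ℕ.≤?_)
  (All.map (λ q≤p j≤q → ℕ.<⇒≱ p<j (ℕ.≤-trans j≤q q≤p))
    (Linked⇒All (λ q≤p r≤q → ℕ.≤-trans r≤q q≤p) ℕ.≤-refl desc)))

paired⇒even : ∀ {ps} → Paired ps → ∀ j → 2 ∣ atLeast j ps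
paired⇒even []                  j = 2 ∣0
paired⇒even (pair {p} {ps} twins) j with atLeast-pair j p ps
... | inj₁ eq = ≡.subst (2 ∣_) (≡.sym eq) (∣m∣n⇒∣m+n ∣-refl (paired⇒even twins j))
... | inj₂ eq = ≡.subst (2 ∣_) (≡.sym eq) (paired⇒even twins j)

-- If the first part `p` exceeds the next, exactly one part is at least `p`, an odd count. Otherwise
-- the first two parts agree, and removing both changes every count by 0 or 2.
even⇒paired : ∀ {ps} → All (1 ℕ.≤_) ps → Linked ℕ._≥_ ps →
  (∀ j → 1 ℕ.≤ j → 2 ∣ atLeast j ps) → Paired ps
even⇒paired {[]}     _           _    even = []
even⇒paired {p ∷ ps} (1≤p ∷ pos) desc even with head-bound desc
... | ps≤p with ℕ.m≤n⇒m<n∨m≡n ps≤p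
...   | inj₁ ps<p = contradiction
  (≡.subst (2 ∣_) (≡.trans (≡.cong length (List.filter-accept (p ℕ.≤?_) {xs = ps} ℕ.≤-refl))
    (≡.cong suc (atLeast-small p (Linked.tail desc) ps<p))) (even p 1≤p))
  (>⇒∤ ℕ.≤-refl)
even⇒paired {p ∷ []}     (() ∷ _)          _    even | _ | inj₂ ≡.refl
even⇒paired {p ∷ p ∷ ps} (1≤p ∷ _ ∷ pos) desc even | _ | inj₂ ≡.refl =
  pair (even⇒paired pos (Linked.tail (Linked.tail desc)) even′)
  where
  even′ : ∀ j → 1 ℕ.≤ j → 2 ∣ atLeast j ps
  even′ j 1≤j with atLeast-pair j p ps
  ... | inj₁ eq = ∣m+n∣m⇒∣n (≡.subst (2 ∣_) eq (even j 1≤j)) ∣-refl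
  ... | inj₂ eq = ≡.subst (2 ∣_) eq (even j 1≤j)

evenConjugate⇒paired : ∀ ν → EvenConjugate ν → Paired (parts ν)
evenConjugate⇒paired ν even = even⇒paired (positive ν) (decreasing ν) even′
  where
  even′ : ∀ j → 1 ℕ.≤ j → 2 ∣ atLeast j (parts ν)
  even′ (suc j) _ with j ℕ.<? part ν 1
  ... | yes j<ν₁ = All.applyUpTo⁻ suc (part ν 1) (All.map⁻ even) j<ν₁
  -- `conjugate` lists only the columns up to `ν₁`; beyond them the count is zero, hence even.
  ... | no  j≮ν₁ = ≡.subst (2 ∣_) (≡.sym (atLeast-small (suc j) (decreasing ν) (s≤s (ℕ.≮⇒≥ j≮ν₁)))) (2 ∣0)

paired⇒evenConjugate : ∀ ν → Paired (parts ν) → EvenConjugate ν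
paired⇒evenConjugate ν twins = All.map⁺ (All.applyUpTo⁺₂ suc (part ν 1) (λ j → paired⇒even twins (suc j)))

toPartition : ∀ {n B ps} → Admissible n B ps → Partition
toPartition {ps = ps} adm = record
  { parts = ps ; positive = Admissible.pos adm ; decreasing = Admissible.desc adm }

partitions : ℕ → ℕ → List Partition
partitions n B = All.reduce toPartition (paired-sound n B)

-- Lets uniqueness and membership be transferred from sequences to partitions.
parts-partitions : ∀ n B → List.map parts (partitions n B) ≡ paired n B
parts-partitions n B = go (paired-sound n B)
  where
  go : ∀ {pss} (adm : All (Admissible n B) pss) → List.map parts (All.reduce toPartition adm) ≡ pss
  go []        = ≡.refl
  go (_ ∷ adm) = ≡.cong (_ ∷_) (go adm)

partitions-unique : ∀ n B → Unique (partitions n B)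
partitions-unique n B =
  Unique.map⁻ (≡.subst Unique (≡.sym (parts-partitions n B)) (paired-unique n B))

partitions-sound : ∀ n B →
  All (λ ν → length (parts ν) ℕ.≤ double n × EvenConjugate ν) (partitions n B)
partitions-sound n B = go (paired-sound n B)
  where
  go : ∀ {pss} (adm : All (Admissible n B) pss) →
    All (λ ν → length (parts ν) ℕ.≤ double n × EvenConjugate ν) (All.reduce toPartition adm)
  go []        = []
  go (a ∷ adm) =
    (Admissible.short a , paired⇒evenConjugate (toPartition a) (Admissible.twins a)) ∷ go adm

partitions-complete : ∀ n B ν → length (parts ν) ℕ.≤ double n → EvenConjugate ν →
  part ν 1 ℕ.≤ B → ν ∈ partitions n B
partitions-complete n B ν short even bound
  with ∈.∈-map⁻ parts (≡.subst (parts ν ∈_) (≡.sym (parts-partitions n B)) (paired-complete n B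
    (admissible (positive ν) (decreasing ν) short bound (evenConjugate⇒paired ν even))))
... | μ , μ∈ , eq = ≡.subst (_∈ partitions n B) (≡.sym (parts-injective eq)) μ∈

-- Sums with finite support

unique-pull : {X : Set} (xs : List X) {y : X} {ys : List X} →
  Unique (xs List.++ y ∷ ys) → Unique (y ∷ xs List.++ ys)
unique-pull []       u          = u
unique-pull (x ∷ xs) (x≢ ∷ u) with unique-pull xs u | All.++⁻ xs x≢
... | y≢ ∷ u′ | x≢xs , x≢y ∷ x≢ys =
  (≢-sym x≢y ∷ y≢) ∷ All.++⁺ x≢xs x≢ys ∷ u′

module Support (R : CommutativeRing 0ℓ 0ℓ) where

  open CommutativeRing R hiding (zero)
  open ListSum R
  open CommutativeSemigroupProperties +-commutativeSemigroup using (x∙yz≈y∙xz)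

  ∑-zero : {X : Set} (xs : List X) (f : X → Carrier) → (∀ {x} → x ∈ xs → f x ≈ 0#) → ∑ xs f ≈ 0#
  ∑-zero []       f f≈0 = refl
  ∑-zero (x ∷ xs) f f≈0 = trans (+-cong (f≈0 (here ≡.refl)) (∑-zero xs f (f≈0 ∘ there))) (+-identityʳ 0#)

  ∑-insert : {X : Set} (xs : List X) (y : X) (ys : List X) (f : X → Carrier) →
    ∑ (xs List.++ y ∷ ys) f ≈ f y + ∑ (xs List.++ ys) f
  ∑-insert []       y ys f = refl
  ∑-insert (x ∷ xs) y ys f = trans (+-congˡ (∑-insert xs y ys f)) (x∙yz≈y∙xz _ _ _)

  -- Each element of `S` is located in `T` and pulled to the front; once `S` is exhausted, what
  -- remains of `T` contributes zero.
  ∑-support : {X : Set} (f : X → Carrier) (S T : List X) → Unique S → Unique T → S ⊆ T →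
    (∀ {x} → x ∈ T → x ∈ S ⊎ f x ≈ 0#) → ∑ T f ≈ ∑ S f
  ∑-support f []      T _           _    _   outside =
    ∑-zero T f λ x∈T → fromInj₂ (λ ()) (outside x∈T)
  ∑-support f (s ∷ S) T (s≢S ∷ S!) T! S⊆T outside with ∈.∈-∃++ (S⊆T (here ≡.refl))
  ... | xs , ys , ≡.refl with unique-pull xs T!
  ...   | s≢T′ ∷ T′! = trans (∑-insert xs s ys f) (+-congˡ (∑-support f S (xs List.++ ys) S! T′! S⊆T′ outside′))
    where
    S⊆T′ : S ⊆ xs List.++ ys
    S⊆T′ x∈S with ∈-resp-↭ (shift s xs ys) (S⊆T (there x∈S))
    ... | here ≡.refl = contradiction ≡.refl (All.lookup s≢S x∈S)
    ... | there x∈T′  = x∈T′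
    outside′ : ∀ {x} → x ∈ xs List.++ ys → x ∈ S ⊎ f x ≈ 0#
    outside′ x∈T′ with outside (∈-resp-↭ (↭-sym (shift s xs ys)) (there x∈T′))
    ... | inj₁ (here ≡.refl) = contradiction ≡.refl (All.lookup s≢T′ x∈T′)
    ... | inj₁ (there x∈S)   = inj₁ x∈S
    ... | inj₂ fx≈0          = inj₂ fx≈0

-- Congruences and the closed form of the Pfaffian entries

record IsCongruence (S : CommutativeRing 0ℓ 0ℓ)
  (_~_ : Rel (CommutativeRing.Carrier S) 0ℓ) : Set where

  open CommutativeRing S

  field
    ≈⇒~     : ∀ {f g} → f ≈ g → f ~ g
    ~-trans : ∀ {f g h} → f ~ g → g ~ h → f ~ h
    +-~     : ∀ {f f′ g g′} → f ~ f′ → g ~ g′ → (f + g) ~ (f′ + g′)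
    *-~     : ∀ {f f′ g g′} → f ~ f′ → g ~ g′ → (f * g) ~ (f′ * g′)

-- General in `_~_`, so as to serve both for agreement of series below a degree and for equality of
-- series.
module Congruence (S : CommutativeRing 0ℓ 0ℓ) (_~_ : Rel (CommutativeRing.Carrier S) 0ℓ)
  (isCongruence : IsCongruence S _~_) where

  open CommutativeRing S hiding (zero)
  open IsCongruence isCongruence
  open RingProperties ring
  open SemiringSum semiring using (sum)
  open RawSemiringDefs (Semiring.rawSemiring semiring) using (_^_)
  open Exp commutativeSemiring using (^-distrib-*)
  open CommutativeSemigroupProperties *-commutativeSemigroup using (x∙yz≈y∙xz)
  open CommutativeSemigroupProperties +-commutativeSemigroup using () renaming (interchange to +-interchange)
  open Determinants rawRing
  open ≈-Reasoning setoid

  ~-refl : ∀ {f} → f ~ f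
  ~-refl = ≈⇒~ refl

  ~-neg : ∀ {f g} → f ~ g → (- f) ~ (- g)
  ~-neg f~g = ~-trans (≈⇒~ (sym (-1*x≈-x _))) (~-trans (*-~ ~-refl f~g) (≈⇒~ (-1*x≈-x _)))

  ~-sub : ∀ {f f′ g g′} → f ~ f′ → g ~ g′ → (f - g) ~ (f′ - g′)
  ~-sub f~f′ g~g′ = +-~ f~f′ (~-neg g~g′)

  1-~ : ∀ {f} → f ~ 0# → (1# - f) ~ 1#
  1-~ f~0 = ~-trans (~-sub ~-refl f~0) (≈⇒~ (trans (+-congˡ -0#≈0#) (+-identityʳ 1#)))

  [1-][1-]-~ : ∀ {f g} → f ~ 0# → g ~ 0# → ((1# - f) * (1# - g)) ~ 1#
  [1-][1-]-~ f~0 g~0 = ~-trans (*-~ (1-~ f~0) (1-~ g~0)) (≈⇒~ (*-identityˡ 1#))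

  sum-~ : ∀ n {f g : Fin n → Carrier} → (∀ i → f i ~ g i) → sum f ~ sum g
  sum-~ zero    f~g = ~-refl
  sum-~ (suc n) f~g = +-~ (f~g zero) (sum-~ n (f~g ∘ suc))

  *-~ˡ : ∀ c {f g} → f ~ g → (c * f) ~ (c * g)
  *-~ˡ c f~g = *-~ (~-refl {c}) f~g

  *-~0 : ∀ c {f} → f ~ 0# → (c * f) ~ 0#
  *-~0 c f~0 = ~-trans (*-~ˡ c f~0) (≈⇒~ (zeroʳ c))

  pf-~ : ∀ m (A B : Matrix m) → (∀ i j → A i j ~ B i j) → pf m A ~ pf m B
  pf-~ zero          A B A~B = ~-refl
  pf-~ (suc zero)    A B A~B = ~-refl
  pf-~ (suc (suc m)) A B A~B = sum-~ (suc m) λ j → *-~ˡ ((- 1#) ^ toℕ j) (*-~ (A~B zero (suc j))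
    (pf-~ m _ _ λ k l → A~B (suc (punchIn j k)) (suc (punchIn j l))))

  det-~ : ∀ m (A B : Matrix m) → (∀ i j → A i j ~ B i j) → det m A ~ det m B
  det-~ zero    A B A~B = ~-refl
  det-~ (suc m) A B A~B = sum-~ (suc m) λ j → *-~ˡ ((- 1#) ^ toℕ j) (*-~ (A~B zero j)
    (det-~ m _ _ λ k l → A~B (suc k) (punchIn j l)))

  -- In the expansion along the first row, the term of column 0 has a vanishing entry, and every
  -- other minor still contains column 0.
  det-zero-column : ∀ m (A : Matrix (suc m)) → (∀ i → A i zero ~ 0#) → det (suc m) A ~ 0#
  det-zero-column m A A₀~0 = ~-trans (sum-~ (suc m) (vanishing m A A₀~0))
    (≈⇒~ (SemiringSum.sum-replicate-zero semiring (suc m)))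
    where
    vanishing : ∀ m (A : Matrix (suc m)) → (∀ i → A i zero ~ 0#) → ∀ j →
      ((- 1#) ^ toℕ j * (A zero j * det m (λ k l → A (suc k) (punchIn j l)))) ~ 0#
    vanishing m A A₀~0 zero = *-~0 1#
      (~-trans (*-~ (A₀~0 zero) ~-refl) (≈⇒~ (zeroˡ _)))
    vanishing (suc m) A A₀~0 (suc j) = *-~0 ((- 1#) ^ toℕ (suc j))
      (*-~0 (A zero (suc j)) (det-zero-column m (λ k l → A (suc k) (punchIn (suc j) l)) (A₀~0 ∘ suc)))

  [a-w]-[b-w] : ∀ a b w → (a - w) - (b - w) ≈ a - b
  [a-w]-[b-w] a b w = begin
    (a - w) - (b - w)    ≈⟨ +-congˡ (⁻¹-anti-homo-// b w) ⟩
    (a - w) + (w - b)    ≈⟨ +-assoc a (- w) (w - b) ⟩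
    a + (- w + (w - b))  ≈⟨ +-congˡ (+-assoc (- w) w (- b)) ⟨
    a + ((- w + w) - b)  ≈⟨ +-congˡ (+-congʳ (-‿inverseˡ w)) ⟩
    a + (0# - b)         ≈⟨ +-congˡ (+-identityˡ (- b)) ⟩
    a - b                ∎

  -- The top power is split off, in step with the recursion of `A`.
  geometric : Carrier → ℕ → Carrier
  geometric z zero    = 0#
  geometric z (suc K) = geometric z K + z ^ K

  geometric-closed : ∀ z K → (1# - z) * geometric z K ≈ 1# - z ^ K
  geometric-closed z zero    = trans (zeroʳ _) (sym (-‿inverseʳ 1#))
  geometric-closed z (suc K) = begin
    (1# - z) * (geometric z K + z ^ K)
      ≈⟨ distribˡ _ _ _ ⟩
    (1# - z) * geometric z K + (1# - z) * z ^ K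
      ≈⟨ +-cong (geometric-closed z K) (trans ([y-z]x≈yx-zx _ _ _) (+-congʳ (*-identityˡ _))) ⟩
    (1# - z ^ K) + (z ^ K - z * z ^ K)
      ≈⟨ +-assoc _ _ _ ⟩
    1# + (- (z ^ K) + (z ^ K - z * z ^ K))
      ≈⟨ +-congˡ (+-assoc _ _ _) ⟨
    1# + ((- (z ^ K) + z ^ K) - z * z ^ K)
      ≈⟨ +-congˡ (+-congʳ (-‿inverseˡ _)) ⟩
    1# + (0# - z * z ^ K)
      ≈⟨ +-congˡ (+-identityˡ _) ⟩
    1# - z ^ suc K ∎

  module _ {m : ℕ} (x : Fin m → Carrier) (t : Carrier) where

    open MinorSummation S (Fin m) (λ k → 1# - t ^ suc k) (λ k i → x i ^ k) using (A)

    -- The summand for `k` is `(xᵣ - xₛ) (1 - tᵏ⁺¹) zᵏ`, and `(1 - tᵏ⁺¹) zᵏ = zᵏ - t (t z)ᵏ`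
    -- separates two geometric sums.
    A-closed : ∀ K r s → let z = x r * x s in
      A K r s ≈ (x r - x s) * (geometric z K - t * geometric (t * z) K)
    A-closed zero    r s = sym (trans
      (*-congˡ (trans (+-congˡ (trans (-‿cong (zeroʳ t)) -0#≈0#)) (+-identityʳ 0#))) (zeroʳ _))
    A-closed (suc K) r s = begin
      A K r s + (1# - t ^ suc K) * (x r ^ suc K * x s ^ K - x r ^ K * x s ^ suc K)
        ≈⟨ +-cong (A-closed K r s) (*-congˡ difference) ⟩
      (x r - x s) * q + (1# - t ^ suc K) * ((x r - x s) * z ^ K)
        ≈⟨ +-congˡ (x∙yz≈y∙xz _ _ _) ⟩
      (x r - x s) * q + (x r - x s) * ((1# - t ^ suc K) * z ^ K)
        ≈⟨ distribˡ _ _ _ ⟨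
      (x r - x s) * (q + (1# - t ^ suc K) * z ^ K)
        ≈⟨ *-congˡ (+-congˡ (trans ([y-z]x≈yx-zx _ _ _) (+-cong (*-identityˡ _) (-‿cong
             (trans (*-assoc _ _ _) (*-congˡ (sym (^-distrib-* t z K)))))))) ⟩
      (x r - x s) * (q + (z ^ K - t * (t * z) ^ K))
        ≈⟨ *-congˡ (+-interchange _ _ _ _) ⟩
      (x r - x s) * ((geometric z K + z ^ K) + (- (t * geometric (t * z) K) - t * (t * z) ^ K))
        ≈⟨ *-congˡ (+-congˡ (trans (-‿+-comm _ _) (-‿cong (sym (distribˡ _ _ _))))) ⟩
      (x r - x s) * (geometric z (suc K) - t * geometric (t * z) (suc K)) ∎
      where
      z q : Carrier
      z = x r * x s
      q = geometric z K - t * geometric (t * z) K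
      difference : x r ^ suc K * x s ^ K - x r ^ K * x s ^ suc K ≈ (x r - x s) * z ^ K
      difference = begin
        x r ^ suc K * x s ^ K - x r ^ K * x s ^ suc K
          ≈⟨ +-cong (*-assoc _ _ _) (-‿cong (x∙yz≈y∙xz _ _ _)) ⟩
        x r * (x r ^ K * x s ^ K) - x s * (x r ^ K * x s ^ K)
          ≈⟨ [y-z]x≈yx-zx _ _ _ ⟨
        (x r - x s) * (x r ^ K * x s ^ K)
          ≈⟨ *-congˡ (^-distrib-* (x r) (x s) K) ⟨
        (x r - x s) * z ^ K ∎

    -- (1 - t) / ((1 - z) (1 - t z)) = 1 / (1 - z) - t / (1 - t z)
    entry-~ : ∀ K r s h → let z = x r * x s in
      (z ^ K) ~ 0# → ((t * z) ^ K) ~ 0# → ((1# - z) * (1# - t * z)) * h ≈ 1# →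
      A K r s ~ (((x r - x s) * (1# - t)) * h)
    entry-~ K r s h zᴷ~0 wᴷ~0 gh≈1 = ~-trans
      -- Inserting `g * h ≈ 1#` reduces the claim to one about `A K r s * g`, which is free of
      -- denominators.
      (≈⇒~ (trans (sym (*-identityʳ _)) (trans (*-congˡ (sym gh≈1)) (sym (*-assoc _ _ _)))))
      (*-~ (~-trans (≈⇒~ (begin
        A K r s * g
          ≈⟨ *-congʳ (A-closed K r s) ⟩
        ((x r - x s) * (P - t * Q)) * g
          ≈⟨ *-assoc _ _ _ ⟩
        (x r - x s) * ((P - t * Q) * g)
          ≈⟨ *-congˡ ([y-z]x≈yx-zx _ _ _) ⟩
        (x r - x s) * (P * g - (t * Q) * g)
          ≈⟨ *-congˡ (+-cong
               (trans (sym (*-assoc _ _ _)) (*-congʳ (*-comm _ _)))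
               (-‿cong (trans (*-assoc _ _ _) (*-congˡ (trans (*-congˡ (*-comm _ _))
                 (trans (sym (*-assoc _ _ _)) (*-congʳ (*-comm _ _)))))))) ⟩
        (x r - x s) * ((1# - z) * P * (1# - w) - t * ((1# - w) * Q * (1# - z)))
          ≈⟨ *-congˡ (+-cong (*-congʳ (geometric-closed z K))
               (-‿cong (*-congˡ (*-congʳ (geometric-closed w K))))) ⟩
        (x r - x s) * ((1# - z ^ K) * (1# - w) - t * ((1# - w ^ K) * (1# - z))) ∎))
        (~-trans (*-~ ~-refl (~-sub (*-~ (1-~ zᴷ~0) ~-refl) (*-~ ~-refl (*-~ (1-~ wᴷ~0) ~-refl))))
          (≈⇒~ (*-congˡ (begin
            1# * (1# - w) - t * (1# * (1# - z))
              ≈⟨ +-cong (*-identityˡ _) (-‿cong (*-congˡ (*-identityˡ _))) ⟩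
            (1# - w) - t * (1# - z)
              ≈⟨ +-congˡ (-‿cong (trans (x[y-z]≈xy-xz _ _ _) (+-congʳ (*-identityʳ t)))) ⟩
            (1# - w) - (t - w)
              ≈⟨ [a-w]-[b-w] 1# t w ⟩
            1# - t ∎)))))
        ~-refl)
      where
      z w g P Q : Carrier
      z = x r * x s
      w = t * z
      g = (1# - z) * (1# - w)
      P = geometric z K
      Q = geometric w K

-- Truncation by degree and division by Δ

module Truncation (R : CommutativeRing 0ℓ 0ℓ) (m : ℕ) where

  private module R = CommutativeRing R
  open SemiringSum R.semiring using (sum-cong-≋; ∑-distrib-+; *-distribˡ-sum)
  open PowerSeries R
  open CommutativeRing (seriesRing m) hiding (zero)
  open RawSemiringDefs (Semiring.rawSemiring semiring) using (_^_)

  infix 4 _≈[_]_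

  _≈[_]_ : Series m → ℕ → Series m → Set
  f ≈[ d ] g = ∀ a → degree a ℕ.< d → f a R.≈ g a

  -- Degrees add up in a product, so a coefficient below degree `d` involves only such coefficients
  -- of the factors.
  ≈[]-isCongruence : ∀ d → IsCongruence (seriesRing m) _≈[ d ]_
  ≈[]-isCongruence d = record
    { ≈⇒~     = λ f≈g a _ → f≈g a
    ; ~-trans = λ f≈g g≈h a a<d → R.trans (f≈g a a<d) (g≈h a a<d)
    ; +-~     = λ f≈f′ g≈g′ a a<d → R.+-cong (f≈f′ a a<d) (g≈g′ a a<d)
    ; *-~     = λ f≈f′ g≈g′ a a<d → splitSum-cong a λ b c eq → R.*-cong
        (f≈f′ b (ℕ.≤-<-trans (ℕ.≤-trans (ℕ.m≤m+n (degree b) (degree c)) (ℕ.≤-reflexive eq)) a<d))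
        (g≈g′ c (ℕ.≤-<-trans (ℕ.≤-trans (ℕ.m≤n+m (degree c) (degree b)) (ℕ.≤-reflexive eq)) a<d))
    }

  module ≈[] (d : ℕ) = Congruence (seriesRing m) _≈[ d ]_ (≈[]-isCongruence d)

  X-origin : ∀ i q → (X i * q) origin R.≈ R.0#
  X-origin i q = X*-zero i q origin (Vec.lookup-replicate i 0)

  power-small : ∀ y → y origin R.≈ R.0# → ∀ {k d} → d ℕ.≤ k → y ^ k ≈[ d ] 0#
  power-small y y₀ {k} d≤k a a<d = power-order y y₀ k a (ℕ.<-≤-trans a<d d≤k)

  -- Only the constant term lies below degree 1, so constant terms can be computed by congruence.
  origin-small : ∀ y → y origin R.≈ R.0# → y ≈[ 1 ] 0#
  origin-small y y₀ a a<1 with ≡.refl ← degree≡0 a (ℕ.n<1⇒n≡0 a<1) = y₀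

  degree-origin : ∀ n → degree (origin {n}) ≡ 0
  degree-origin zero    = ≡.refl
  degree-origin (suc n) = degree-origin n

  1-origin : ∀ n → const {n} R.1# origin ≡ R.1#
  1-origin zero    = ≡.refl
  1-origin (suc n) = 1-origin n

  const-* : ∀ {n} c (f : Series n) a → CommutativeRing._*_ (seriesRing n) (const c) f a R.≈ c R.* f a
  const-* c f []      = R.refl
  const-* c f (k ∷ a) = R.trans
    (R.+-congˡ (sum-zero k λ _ → splitSum-zero′ a λ _ _ → R.zeroˡ _))
    (R.trans (R.+-identityʳ _) (const-* c (λ b → f (k ∷ b)) a))

  -- Made for polynomials in `t`: as factors they pass through every `Linear` map, by `scalar-hom`.
  record Scalar (w : Series m) : Set where
    constructor scalar
    field
      value : R.Carrier
      acts  : ∀ f a → (w * f) a R.≈ value R.* f a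

  scalar-const : ∀ c → Scalar (const c)
  scalar-const c = scalar c (const-* c)

  scalar-1 : Scalar 1#
  scalar-1 = scalar-const R.1#

  scalar-* : ∀ {v w} → Scalar v → Scalar w → Scalar (v * w)
  scalar-* {v} {w} (scalar c p) (scalar d q) = scalar (c R.* d) λ f a → R.trans
    (*-assoc v w f a) (R.trans (p (w * f) a) (R.trans (R.*-congˡ (q f a)) (R.sym (R.*-assoc c d (f a)))))

  scalar-sub : ∀ {v w} → Scalar v → Scalar w → Scalar (v - w)
  scalar-sub {v} {w} (scalar c p) (scalar d q) = scalar (c R.- d) λ f a → R.trans
    (RingProperties.[y-z]x≈yx-zx ring f v w a)
    (R.trans (R.+-cong (p f a) (R.-‿cong (q f a)))
      (R.sym (RingProperties.[y-z]x≈yx-zx R.ring (f a) c d)))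

  scalar-^ : ∀ {w} → Scalar w → ∀ k → Scalar (w ^ k)
  scalar-^ w zero    = scalar-1
  scalar-^ w (suc k) = scalar-* w (scalar-^ w k)

  record Linear (T : Series m → Series m) : Set where
    field
      cong  : ∀ {f g} → f ≈ g → T f ≈ T g
      +-hom : ∀ f g → T (f + g) ≈ T f + T g
      ·-hom : ∀ c f → T (λ a → c R.* f a) ≈ (λ a → c R.* T f a)

    0-hom : T 0# ≈ 0#
    0-hom a = R.trans (cong (λ _ → R.sym (R.zeroˡ R.0#)) a)
      (R.trans (·-hom R.0# 0# a) (R.zeroˡ _))

    scalar-hom : ∀ {w} → Scalar w → ∀ f → T (w * f) ≈ w * T f
    scalar-hom (scalar c acts) f a = R.trans (cong (acts f) a)
      (R.trans (·-hom c f a) (R.sym (acts (T f) a)))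

  divide-linear : ∀ i j → Linear (divide i j)
  divide-linear i j = record
    { cong  = divide-cong i j
    ; +-hom = λ f g a → ∑-distrib-+ {suc (lookup a j)}
        (λ k → f (shifted a k)) (λ k → g (shifted a k))
    ; ·-hom = λ c f a → R.sym (*-distribˡ-sum {suc (lookup a j)} c (λ k → f (shifted a k)))
    }
    where
    shifted : ∀ a → Fin (suc (lookup a j)) → Exponent m
    shifted a k = updateAt (updateAt a i (suc (toℕ k) ℕ.+_)) j (ℕ._∸ toℕ k)

  /Δ-linear : Linear _/Δ
  /Δ-linear = go (pairs m)
    where
    open Linear
    go : ∀ ps → Linear (λ f → List.foldl (λ g (i , j) → divide i j g) f ps)
    go []             = record
      { cong  = λ f≈g → f≈g
      ; +-hom = λ _ _ _ → R.refl
      ; ·-hom = λ _ _ _ → R.refl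
      }
    go ((i , j) ∷ ps) = record
      { cong  = λ f≈g → cong (go ps) (cong (divide-linear i j) f≈g)
      ; +-hom = λ f g a → R.trans
          (cong (go ps) (+-hom (divide-linear i j) f g) a)
          (+-hom (go ps) (divide i j f) (divide i j g) a)
      ; ·-hom = λ c f a → R.trans
          (cong (go ps) (·-hom (divide-linear i j) c f) a)
          (·-hom (go ps) c (divide i j f) a)
      }

  degree-add : ∀ {n} (a : Exponent n) i k → degree (updateAt a i (k ℕ.+_)) ≡ k ℕ.+ degree a
  degree-add (b ∷ a) zero    k = ℕ.+-assoc k b (degree a)
  degree-add (b ∷ a) (suc i) k = ≡.trans (≡.cong (b ℕ.+_) (degree-add a i k))
    (ℕ-xy.x∙yz≈y∙xz b k (degree a))
    where module ℕ-xy = CommutativeSemigroupProperties ℕ.+-commutativeSemigroup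

  degree-sub : ∀ {n} (a : Exponent n) i k → degree (updateAt a i (ℕ._∸ k)) ℕ.≤ degree a
  degree-sub (b ∷ a) zero    k = ℕ.+-monoˡ-≤ (degree a) (ℕ.m∸n≤m b k)
  degree-sub (b ∷ a) (suc i) k = ℕ.+-monoʳ-≤ b (degree-sub a i k)

  lookup≤degree : ∀ {n} (a : Exponent n) i → lookup a i ℕ.≤ degree a
  lookup≤degree (b ∷ a) zero    = ℕ.m≤m+n b (degree a)
  lookup≤degree (b ∷ a) (suc i) = ℕ.≤-trans (lookup≤degree a i) (ℕ.m≤n+m (degree a) b)

  -- The shift `k` is bounded by the entry of `a` at `j`, hence by its degree. So the exponents read
  -- have degree at most `2 * degree a + 1`, which is below `2 * d`.
  divide-≈[] : ∀ i j {f g d} → f ≈[ d ℕ.+ d ] g → divide i j f ≈[ d ] divide i j g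
  divide-≈[] i j {d = d} f≈g a a<d = sum-cong-≋ {suc (lookup a j)} λ k →
    f≈g (updateAt (updateAt a i (suc (toℕ k) ℕ.+_)) j (ℕ._∸ toℕ k)) (begin-strict
    degree (updateAt (updateAt a i (suc (toℕ k) ℕ.+_)) j (ℕ._∸ toℕ k))
      ≤⟨ degree-sub (updateAt a i (suc (toℕ k) ℕ.+_)) j (toℕ k) ⟩
    degree (updateAt a i (suc (toℕ k) ℕ.+_))
      ≡⟨ degree-add a i (suc (toℕ k)) ⟩
    suc (toℕ k ℕ.+ degree a)
      ≤⟨ s≤s (ℕ.+-monoˡ-≤ (degree a) (ℕ.≤-trans (ℕ.≤-pred (Fin.toℕ<n k)) (lookup≤degree a j))) ⟩
    suc (degree a ℕ.+ degree a)
      <⟨ ℕ.+-monoʳ-< (suc (degree a)) (ℕ.n<1+n _) ⟩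
    suc (degree a) ℕ.+ suc (degree a)
      ≤⟨ ℕ.+-mono-≤ a<d a<d ⟩
    d ℕ.+ d ∎)
    where open ℕ.≤-Reasoning

  -- Division by X i - X j uses coefficients of larger degree; an ample bound suffices.
  precision : List (Fin m × Fin m) → ℕ → ℕ
  precision []       d = d
  precision (_ ∷ ps) d = precision ps d ℕ.+ precision ps d

  /Δ-≈[] : ∀ d {f g} → f ≈[ precision (pairs m) d ] g → f /Δ ≈[ d ] g /Δ
  /Δ-≈[] d = go (pairs m)
    where
    go : ∀ ps {f g} → f ≈[ precision ps d ] g →
      List.foldl (λ g (i , j) → divide i j g) f ps ≈[ d ] List.foldl (λ g (i , j) → divide i j g) g ps
    go []             f≈g = f≈g
    go ((i , j) ∷ ps) f≈g = go ps (divide-≈[] i j f≈g)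

-- Index arithmetic

double≡2* : ∀ n → double n ≡ 2 ℕ.* n
double≡2* zero    = ≡.refl
double≡2* (suc n) = ≡.trans (≡.cong (λ k → suc (suc k)) (double≡2* n)) (≡.sym (ℕ.*-suc 2 n))

double-mono-≤ : ∀ {k n} → k ℕ.≤ n → double k ℕ.≤ double n
double-mono-≤ z≤n       = z≤n
double-mono-≤ (s≤s k≤n) = s≤s (s≤s (double-mono-≤ k≤n))

p+m∸i≡m∸i+p : ∀ p {m i} → i ℕ.≤ m → p ℕ.+ m ℕ.∸ i ≡ (m ℕ.∸ i) ℕ.+ p
p+m∸i≡m∸i+p p {m} {i} i≤m = ≡.trans (ℕ.+-∸-assoc p i≤m) (ℕ.+-comm p (m ℕ.∸ i))

p+m+1∸i≡1+m∸i+p : ∀ p {m i} → i ℕ.≤ m → p ℕ.+ m ℕ.+ 1 ℕ.∸ i ≡ suc ((m ℕ.∸ i) ℕ.+ p)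
p+m+1∸i≡1+m∸i+p p {m} {i} i≤m = ≡.trans (≡.cong (ℕ._∸ i) (ℕ.+-comm (p ℕ.+ m) 1))
  (≡.trans (p+m∸i≡m∸i+p (suc p) i≤m) (ℕ.+-suc (m ℕ.∸ i) p))

-- Schur expansion of the Pfaffian quotient

module SchurExpansion (R : CommutativeRing 0ℓ 0ℓ) (τ : CommutativeRing.Carrier R)
  (n-1 m : ℕ) (m≡2n : m ≡ double (suc n-1)) where

  private module R = CommutativeRing R
  open PowerSeries R
  open CommutativeRing (seriesRing m) hiding (zero)
  open RawSemiringDefs (Semiring.rawSemiring semiring) using (_^_; product)
  open Determinants (CommutativeRing.rawRing (seriesRing m))
  open Truncation R m
  open Linear /Δ-linear

  n : ℕ
  n = suc n-1

  t : Carrier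
  t = const τ

  x : Fin m → Carrier
  x = X

  open MinorSummation (seriesRing m) (Fin m) (λ k → 1# - t ^ suc k) (λ k i → x i ^ k)
    using (A; weight; columns; pf-expansion)

  ≈-isCongruence : IsCongruence (seriesRing m) _≈_
  ≈-isCongruence = record
    { ≈⇒~     = λ f≈g → f≈g
    ; ~-trans = λ {f} {g} {h} → trans {f} {g} {h}
    ; +-~     = λ {f} {f′} {g} {g′} → +-cong {f} {f′} {g} {g′}
    ; *-~     = λ {f} {f′} {g} {g′} → *-cong {f} {f′} {g} {g′}
    }

  entry-series : Fin m → Fin m → Carrier
  entry-series i j = ((x i - x j) * (1# - t)) * ((1# - x i * x j) * (1# - t * (x i * x j))) ⁻¹

  -- Both `z` and `t z` have constant term zero, so their `K`-th powers vanish below degree `K`; the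
  -- denominator has constant term 1, so `⁻¹` is its inverse.
  A≈entry : ∀ {d K} → d ℕ.≤ K → ∀ i j → A K i j ≈[ d ] entry-series i j
  A≈entry {d} {K} d≤K i j = ≈[].entry-~ d x t K i j (g ⁻¹)
    (power-small z z₀ d≤K) (power-small w w₀ d≤K) (⁻¹-inverseʳ g g₀)
    where
    z w g : Carrier
    z = x i * x j
    w = t * z
    g = (1# - z) * (1# - w)
    z₀ : z origin R.≈ R.0#
    z₀ = X-origin i (x j)
    w₀ : w origin R.≈ R.0#
    w₀ = R.trans (const-* τ z origin) (R.trans (R.*-congˡ z₀) (R.zeroʳ τ))
    g₀ : g origin R.≈ R.1#
    g₀ = R.trans
      (≈[].[1-][1-]-~ 1 {z} {w} (origin-small z z₀) (origin-small w w₀)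
        origin (s≤s (ℕ.≤-reflexive (degree-origin m))))
      (R.reflexive (1-origin m))

  -- Formulated for sequences, so that `summand (parts ν)` unfolds to the summand of the theorem.
  alternant : List ℕ → Carrier
  alternant ps = det m λ i j → x i ^ (entry ps (index j) ℕ.+ m ℕ.∸ index j)

  coefficient : List ℕ → Carrier
  coefficient ps = product λ (k : Fin n) → let i = 2 ℕ.* index k in
    1# - t ^ (entry ps i ℕ.+ m ℕ.+ 1 ℕ.∸ i)

  alternant-columns : ∀ ps → det m (λ i j → columns m ps j i) ≈ alternant ps
  alternant-columns ps = Congruence.det-~ (seriesRing m) _≈_ ≈-isCongruence m (λ i j → columns m ps j i) _ λ i j →
    reflexive (≡.cong (x i ^_) (≡.sym (p+m∸i≡m∸i+p (entry ps (index j)) (Fin.toℕ<n j))))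

  -- As `cₖ = 1 - tᵏ⁺¹`, the column exponent `k = λᵢ - i + 2n` yields the power `λᵢ - i + 2n + 1`;
  -- the truncated subtraction is exact since `i` is at most `m`.
  weight-coefficient : ∀ ps → weight n ps ≡ coefficient ps
  weight-coefficient ps = MonoidSum.sum-cong-≗ *-monoid {n} λ k → ≡.cong (λ e → 1# - t ^ e) (≡.sym
    (≡.trans (≡.cong (λ i → entry ps i ℕ.+ m ℕ.+ 1 ℕ.∸ i) (≡.sym (double≡2* (index k))))
      (≡.trans (p+m+1∸i≡1+m∸i+p (entry ps (double (index k)))
        (ℕ.≤-trans (double-mono-≤ (Fin.toℕ<n k)) (ℕ.≤-reflexive (≡.sym m≡2n))))
        (≡.cong (λ d → suc ((d ℕ.∸ double (index k)) ℕ.+ entry ps (double (index k)))) m≡2n))))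

  coefficient-scalar : ∀ ps → Scalar (coefficient ps)
  coefficient-scalar ps = go n λ k → 2 ℕ.* index k
    where
    go : ∀ n (i : Fin n → ℕ) →
      Scalar (product λ k → 1# - t ^ (entry ps (i k) ℕ.+ m ℕ.+ 1 ℕ.∸ i k))
    go zero    i = scalar-1
    go (suc n) i = scalar-* (scalar-sub scalar-1 (scalar-^ (scalar-const τ) (entry ps (i zero) ℕ.+ m ℕ.+ 1 ℕ.∸ i zero))) (go n (i ∘ suc))

  -- The first column consists of the powers of the `xᵢ` with exponent `λ₁ + m - 1`, which vanish
  -- below degree `λ₁`.
  alternant-small : ∀ ps {d} → d ℕ.≤ entry ps 1 → alternant ps ≈[ d ] 0#
  alternant-small ps {d} d≤p = go m _ m≡2n λ i j j≡0 →
    power-small (x i) (x₀ i) (ℕ.≤-trans d≤p (ℕ.≤-trans (ℕ.m≤n+m (entry ps 1) (m ℕ.∸ 1))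
      (ℕ.≤-reflexive (≡.trans (≡.sym (p+m∸i≡m∸i+p (entry ps 1) 1≤m))
        (≡.cong (λ i → entry ps (suc i) ℕ.+ m ℕ.∸ suc i) (≡.sym j≡0))))))
    where
    1≤m : 1 ℕ.≤ m
    1≤m = ≡.subst (1 ℕ.≤_) (≡.sym m≡2n) (s≤s z≤n)
    x₀ : ∀ i → x i origin R.≈ R.0#
    x₀ i = R.trans (sym {x i * 1#} {x i} (*-identityʳ (x i)) origin) (X-origin i 1#)
    -- The size is generalised because `m` is a successor only up to the equation `m≡2n`.
    go : ∀ l (M : Matrix l) → l ≡ double n → (∀ i j → toℕ j ≡ 0 → M i j ≈[ d ] 0#) →
      det l M ≈[ d ] 0#
    go (suc l) M _ M₀ = ≈[].det-zero-column d l M λ i → M₀ i zero ≡.refl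

  summand : List ℕ → Carrier
  summand ps = coefficient ps * (alternant ps /Δ)

  -- Gives the convergence of the sum: partitions with a large first part do not reach the
  -- coefficients below degree `d`.
  summand-vanishing : ∀ ps d → precision (pairs m) d ℕ.≤ entry ps 1 → summand ps ≈[ d ] 0#
  summand-vanishing ps d large a a<d = R.trans
    (Scalar.acts (coefficient-scalar ps) (alternant ps /Δ) a)
    (R.trans (R.*-congˡ (R.trans
      (/Δ-≈[] d {alternant ps} {0#} (alternant-small ps large) a a<d) (0-hom a)))
      (R.zeroʳ _))

  open ListSum using (∑-map)
  open ListSum (seriesRing m) using (∑)
  open ListSum R using () renaming (∑ to ∑ᴿ)

  ∑-at : {Z : Set} (zs : List Z) (f : Z → Carrier) (a : Exponent m) →
    ∑ zs f a ≡ ∑ᴿ zs (λ z → f z a)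
  ∑-at []       f a = ≡.refl
  ∑-at (z ∷ zs) f a = ≡.cong (f z a R.+_) (∑-at zs f a)

  ∑-/Δ : ∀ pss → ∑ pss (λ ps → weight n ps * det m (λ i j → columns m ps j i)) /Δ ≈ ∑ pss summand
  ∑-/Δ []         = 0-hom
  ∑-/Δ (ps ∷ pss) a = R.trans
    (+-hom (weight n ps * det m (λ i j → columns m ps j i)) _ a)
    (R.+-cong
      (R.trans
        (cong (*-cong {weight n ps} {coefficient ps} (reflexive (weight-coefficient ps)) (alternant-columns ps)) a)
        (scalar-hom (coefficient-scalar ps) (alternant ps) a))
      (∑-/Δ pss a))

  -- The witness for `a` consists of the partitions with first part at most `B`; any further
  -- admissible ones contribute zero at `a`.
  schur-expansion : HasSum (λ ν → length (parts ν) ℕ.≤ m × EvenConjugate ν)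
    (λ ν → summand (parts ν)) (pf m entry-series /Δ)
  schur-expansion a = partitions n B , partitions-unique n B ,
    ≡.subst (λ l → All (λ ν → length (parts ν) ℕ.≤ l × EvenConjugate ν) (partitions n B))
      (≡.sym m≡2n) (partitions-sound n B) ,
    λ T T! T-admissible S⊆T → begin
      ∑ T (summand ∘ parts) a
        ≡⟨ ∑-at T (summand ∘ parts) a ⟩
      ∑ᴿ T (λ ν → summand (parts ν) a)
        ≈⟨ Support.∑-support R (λ ν → summand (parts ν) a) (partitions n B) T
             (partitions-unique n B) T! S⊆T (outside ∘ All.lookup T-admissible) ⟩
      ∑ᴿ (partitions n B) (λ ν → summand (parts ν) a)
        ≡⟨ ∑-map R parts (partitions n B) (λ ps → summand ps a) ⟨
      ∑ᴿ (List.map parts (partitions n B)) (λ ps → summand ps a)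
        ≡⟨ ≡.cong (λ pss → ∑ᴿ pss (λ ps → summand ps a)) (parts-partitions n B) ⟩
      ∑ᴿ (paired n B) (λ ps → summand ps a)
        ≡⟨ ∑-at (paired n B) summand a ⟨
      ∑ (paired n B) summand a
        ≈⟨ ∑-/Δ (paired n B) a ⟨
      (∑ (paired n B) (λ ps → weight n ps * det m (λ i j → columns m ps j i)) /Δ) a
        ≈⟨ cong (pf-expansion m n B K m≡2n ≡.refl id) a ⟨
      (pf m (A K) /Δ) a
        ≈⟨ /Δ-≈[] d {pf m (A K)} {pf m entry-series}
             (≈[].pf-~ B m (A K) entry-series (A≈entry B≤K)) a ℕ.≤-refl ⟩
      (pf m entry-series /Δ) a ∎
    where
    open ≈-Reasoning R.setoid
    -- The quotient below degree `d`, in particular at `a`, depends only on coefficients below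
    -- degree `B`. There the entries agree with `A K`, as `B ≤ K`, and `suc K` computes to
    -- `double n + B`, as `pf-expansion` demands.
    d B K : ℕ
    d = suc (degree a)
    B = precision (pairs m) d
    K = suc (double n-1) ℕ.+ B
    B≤K : B ℕ.≤ K
    B≤K = ℕ.m≤n+m B (suc (double n-1))
    outside : ∀ {ν} → length (parts ν) ℕ.≤ m × EvenConjugate ν →
      ν ∈ partitions n B ⊎ summand (parts ν) a R.≈ R.0#
    outside {ν} (short , even) with part ν 1 ℕ.≤? B
    ... | yes ν₁≤B = inj₁ (partitions-complete n B ν
      (≡.subst (length (parts ν) ℕ.≤_) m≡2n short) even ν₁≤B)
    ... | no  ν₁≰B = inj₂ (summand-vanishing (parts ν) d (ℕ.<⇒≤ (ℕ.≰⇒> ν₁≰B)) a ℕ.≤-refl)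

theorem4 : (n : ℕ) → n ℕ.≥ 1 →
    let open ℤ[t]⟦x⟧ (2 ℕ.* n) in
    HasSum
      (λ ν → length (parts ν) ℕ.≤ 2 ℕ.* n × EvenConjugate ν)
      (λ ν → product (λ (k : Fin n) → let i = 2 ℕ.* index k in
                1# - t ^ (part ν i ℕ.+ 2 ℕ.* n ℕ.+ 1 ℕ.∸ i))
             * schur ν)
      (pf (2 ℕ.* n) (λ i j →
          ((x i - x j) * (1# - t))
          * ((1# - x i * x j) * (1# - t * (x i * x j))) ⁻¹)
       /Δ)
-- `2 * n` does not compute to `double n`, so the size is passed together with an equation.
theorem4 (suc n-1) _ = SchurExpansion.schur-expansion ℤ[t].polyRing ℤ[t].indeterminate
  n-1 (2 ℕ.* suc n-1) (≡.sym (double≡2* (suc n-1)))
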